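{- Let $m\in\mathbb{Z}$ and $n\in\mathbb{Z}^+$. Suppose that $p$ is an odd prime dividing $m-4$. Then $$\nu_p\left(\sum_{k=0}^{n-1}\frac{\binom{2k}{k}}{m^k}\right)\geq \nu_p(n)\quad\text{and}\quad \nu_p\left(\sum_{k=0}^{n-1}\binom{n-1}{k}(-1)^k\frac{\binom{2k}{k}}{m^k}\right)\geq \nu_p(n).$$ Furthermore, $$\frac1n\sum_{k=0}^{n-1}\frac{\binom{2k}{k}}{m^k}\equiv\frac{\binom{2n-1}{n-1}}{4^{n-1}}+\delta_{p,3}\,[3\mid n]\,\frac{m-4}{3}\binom{2n/3^{\nu_3(n)}-1}{n/3^{\nu_3(n)}-1}\pmod{p^{\nu_p(m-4)}}$$ and also $$\frac1n\sum_{k=0}^{n-1}\binom{n-1}{k}(-1)^k\frac{\binom{2k}{k}}{m^k}\equiv\frac{C_{n-1}}{4^{n-1}}\pmod{p^{\nu_p(m-4)-\delta_{p,3}}}.$$ Thus, for every $a\in\mathbb{Z}^+$ we have $$\frac1{p^a}\sum_{k=0}^{p^a-1}\frac{\binom{2k}{k}}{m^k}\equiv 1+\delta_{p,3}\frac{m-4}{3}\equiv\frac{m-1}{3}\pmod p$$ and also, provided $p\neq 3$, $$\frac1{p^a}\sum_{k=0}^{p^a-1}\binom{p^a-1}{k}(-1)^k\frac{\binom{2k}{k}}{m^k}\equiv-1\pmod p.$$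
   Context: $\mathbb{Z}^+=\{1,2,3,\ldots\}$. For a prime $p$ and an integer $x$, $\nu_p(x)=\sup\{a\in\mathbb{Z}: p^a\mid x\}$ (so $\nu_p(0)=+\infty$), extended to rational numbers by $\nu_p(x/y)=\nu_p(x)-\nu_p(y)$ for $x\in\mathbb{Z}$, $y\in\mathbb{Z}^+$. $\delta_{p,3}$ equals $1$ if $p=3$ and $0$ otherwise; $[3\mid n]$ equals $1$ if $3$ divides $n$ and $0$ otherwise. $C_k=\frac{1}{k+1}\binom{2k}{k}$ is the $k$-th Catalan number. For rational numbers $r,s$ and an integer $e\geq 0$, $r\equiv s\pmod{p^e}$ means $\nu_p(r-s)\geq e$. When $m=4$ (so $\nu_p(m-4)=+\infty$), a congruence modulo $p^{\nu_p(m-4)}$ or $p^{\nu_p(m-4)-\delta_{p,3}}$ means congruence modulo every power of $p$, i.e. equality. -}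

module Defs where

open import Data.Bool.Base using (if_then_else_)
open import Data.Empty using (⊥-elim)
open import Data.Fin.Base using (toℕ)
open import Data.Integer.Base as ℤ using (ℤ; +_; +0; +[1+_]; -[1+_]; -1ℤ; 0ℤ; 1ℤ)
import Data.Integer.Divisibility as ℤ
open import Data.Nat.Base as ℕ using (ℕ; zero; suc; NonZero; NonTrivial; z≤n; s≤s)
open import Data.Nat.Combinatorics using (_C_)
open import Data.Nat.Divisibility using (_∣_; _∣?_; ∣-refl; ∣⇒≤; 1∣_)
open import Data.Nat.DivMod using (_/_)
open import Data.Nat.Primality using (Prime; euclidsLemma; prime⇒nonZero; prime⇒nonTrivial)
import Data.Nat.Properties as ℕ
open import Data.Rational.Base as ℚ using (ℚ; ↥_; ↧ₙ_)
open import Data.Rational.Literals using (fromℤ)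
open import Data.Rational.Properties using (+-0-commutativeMonoid)
open import Data.Sum.Base using (inj₁; inj₂; [_,_]′)
open import Level using (0ℓ)
open import Relation.Binary.PropositionalEquality using (refl; subst)
open import Relation.Nullary using (¬_; Dec; yes; no; ⌊_⌋)
open import Relation.Nullary.Construct.Add.Supremum using (_⁺; ⊤⁺; [_])
open import Relation.Unary using (Pred; Decidable)
open import Algebra.Properties.CommutativeMonoid.Sum +-0-commutativeMonoid using (sum-syntax)
import Relation.Binary.Construct.Add.Supremum.NonStrict ℤ._≤_ as Sup

open Sup public using (_≤⁺_)

------------------------------------------------------------------------
-- p-adic valuations, with values in ℤ ∪ {+∞}

-- The largest a ≤ b satisfying P (and 0 if there is none).
largest : {P : Pred ℕ 0ℓ} → Decidable P → ℕ → ℕ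
largest P? zero    = zero
largest P? (suc b) with P? (suc b)
... | yes _ = suc b
... | no  _ = largest P? b

-- The search may stop at n, because p ^ a ∣ n forces a < p ^ a ≤ n when
-- p ≥ 2; see νℕ-greatest.
νℕ : ℕ → (n : ℕ) .{{_ : NonZero n}} → ℕ
νℕ p n = largest (λ a → (p ℕ.^ a) ∣? n) n

νℤ : ℕ → ℤ → ℤ ⁺
νℤ p +0       = ⊤⁺
νℤ p +[1+ n ] = [ + νℕ p (suc n) ]
νℤ p -[1+ n ] = [ + νℕ p (suc n) ]

infixl 6 _-⁺_

_-⁺_ : ℤ ⁺ → ℤ → ℤ ⁺
⊤⁺    -⁺ j = ⊤⁺
[ i ] -⁺ j = [ i ℤ.- j ]

-- ν_p(x / y) = ν_p(x) - ν_p(y), taken on the fraction in lowest terms.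
ν : ℕ → ℚ → ℤ ⁺
ν p q@record{} = νℤ p (↥ q) -⁺ + νℕ p (↧ₙ q)

infix 4 _≋_[mod_↑_]

-- r ≡ s (mod p ^ e).  For e = ⊤⁺ this says ν_p(r - s) = +∞, i.e. r = s.
_≋_[mod_↑_] : ℚ → ℚ → ℕ → ℤ ⁺ → Set
r ≋ s [mod p ↑ e ] = e ≤⁺ ν p (r ℚ.- s)

-- νℕ p n is the supremum of { a : p ^ a ∣ n }.

private
  module _ {P : Pred ℕ 0ℓ} (P? : Decidable P) where

    largest-satisfies : P 0 → ∀ b → P (largest P? b)
    largest-satisfies P0 zero = P0
    largest-satisfies P0 (suc b) with P? (suc b)
    ... | yes Pb = Pb
    ... | no  _  = largest-satisfies P0 b

    largest-greatest : ∀ b {a} → a ℕ.≤ b → P a → a ℕ.≤ largest P? b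
    largest-greatest zero    a≤b _ = a≤b
    largest-greatest (suc b) a≤b Pa with P? (suc b)
    ... | yes _  = a≤b
    ... | no ¬Pb with ℕ.m≤n⇒m<n∨m≡n a≤b
    ...   | inj₁ (s≤s a≤b′) = largest-greatest b a≤b′ Pa
    ...   | inj₂ refl       = ⊥-elim (¬Pb Pa)

  a<p^a : ∀ p .{{_ : NonTrivial p}} a → a ℕ.< p ℕ.^ a
  a<p^a p zero    = s≤s z≤n
  a<p^a p (suc a) = begin-strict
    suc a            ≤⟨ a<p^a p a ⟩
    p ℕ.^ a          <⟨ ℕ.m<m*n (p ℕ.^ a) p (ℕ.nonTrivial⇒n>1 p) ⟩
    p ℕ.^ a ℕ.* p    ≡⟨ ℕ.*-comm (p ℕ.^ a) p ⟩
    p ℕ.* p ℕ.^ a    ∎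
    where
    open ℕ.≤-Reasoning
    instance _ = ℕ.m^n≢0 p a {{ℕ.nonTrivial⇒nonZero p}}

νℕ-divides : ∀ p n .{{_ : NonZero n}} → p ℕ.^ νℕ p n ∣ n
νℕ-divides p n = largest-satisfies (λ a → (p ℕ.^ a) ∣? n) (1∣ n) n

νℕ-greatest : ∀ p .{{_ : NonTrivial p}} n .{{_ : NonZero n}} a →
              p ℕ.^ a ∣ n → a ℕ.≤ νℕ p n
νℕ-greatest p n a p^a∣n = largest-greatest (λ a → (p ℕ.^ a) ∣? n) n
  (ℕ.≤-trans (ℕ.<⇒≤ (a<p^a p a)) (∣⇒≤ p^a∣n)) p^a∣n

-- n / p ^ ν_p(n)
cofactor : (p : ℕ) .{{_ : NonZero p}} (n : ℕ) .{{_ : NonZero n}} → ℕ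
cofactor p n = n / (p ℕ.^ νℕ p n)
  where instance _ = ℕ.m^n≢0 p (νℕ p n)

------------------------------------------------------------------------
-- Iverson bracket and Kronecker delta

⟦_⟧ : {P : Set} → Dec P → ℤ
⟦ P? ⟧ = if ⌊ P? ⌋ then 1ℤ else 0ℤ

δ : ℕ → ℕ → ℤ
δ i j = ⟦ i ℕ.≟ j ⟧

------------------------------------------------------------------------
-- Binomial coefficients and sums

infix 7 _÷ℤ_

_÷ℤ_ : (x y : ℤ) .{{_ : ℤ.NonZero y}} → ℚ
x ÷ℤ y = fromℤ x ℚ.÷ fromℤ y

catalan : ℕ → ℚ
catalan k = + ((2 ℕ.* k) C k) ℚ./ suc k

^-nonZero : ∀ m .{{_ : ℤ.NonZero m}} k → ℤ.NonZero (m ℤ.^ k)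
^-nonZero m zero    = _
^-nonZero m (suc k) = ℤ.i*j≢0 m (m ℤ.^ k)
  where
  import Data.Integer.Properties as ℤ
  instance _ = ^-nonZero m k

module _ (m : ℤ) .{{_ : ℤ.NonZero m}} where

  term : ℕ → ℚ
  term k = (+ ((2 ℕ.* k) C k) ÷ℤ (m ℤ.^ k)) {{^-nonZero m k}}

  S : ℕ → ℚ
  S n = ∑[ k < n ] term (toℕ k)

  T : ℕ → ℚ
  T n = ∑[ k < n ] (fromℤ (+ ((n ℕ.∸ 1) C toℕ k) ℤ.* -1ℤ ℤ.^ toℕ k) ℚ.* term (toℕ k))

------------------------------------------------------------------------
-- The denominators m ^ k and p ^ a do not vanish

p∣m-4⇒m≢0 : ∀ {m p} → Prime p → ¬ (2 ∣ p) → + p ℤ.∣ (m ℤ.- + 4) → ℤ.NonZero m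
p∣m-4⇒m≢0 {+[1+ _ ]} _ _ _ = _
p∣m-4⇒m≢0 { -[1+ _ ]} _ _ _ = _
p∣m-4⇒m≢0 {+0} {p} pp 2∤p p∣4 = ⊥-elim ([ absurd , absurd ]′ (euclidsLemma 2 2 pp p∣4))
  where
  absurd : ¬ (p ∣ 2)
  absurd p∣2 = 2∤p (subst (2 ∣_) (ℕ.≤-antisym 2≤p (∣⇒≤ p∣2)) ∣-refl)
    where
    2≤p : 2 ℕ.≤ p
    2≤p = ℕ.nonTrivial⇒n>1 p {{prime⇒nonTrivial pp}}

prime^≢0 : ∀ {p} → Prime p → ∀ a → NonZero (p ℕ.^ a)
prime^≢0 {p} pp a = ℕ.m^n≢0 p a {{prime⇒nonZero pp}}

{-# OPTIONS --safe #-}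

-- Put t = m - 4, n = N + 1 and c(N) = C(2N+1, N). Induction on N gives
--   mᴺ S(n) = n ∑ᵢ tⁱ c(N) C(N,i) B(i,i),   B(i,j) = i! j! / (i+j+1)!.
-- As B(i,i) is an integral combination of fractions 1/r with r ≤ 2i+1 < pⁱ, the i-th term of the
-- sum is divisible by t for all i ≥ 1, except for i = 1 when p = 3; that exceptional term is
-- evaluated modulo 3 by Lucas' congruence. Since also m ≡ 4 modulo t, S(n)/n ≡ c(N)/4ᴺ up to it.
-- Summation by parts turns the alternating sum into T(n)/n = ∑ₖ C(N,k) (-1)ᵏ S(k+1)/(k+1), where
-- S(k+1)/(k+1) may be replaced by c(k)/4ᵏ, its value for m = 4; and for m = 4 the alternating sum
-- T(n) is a Beta-type moment, equal to C(2N,N)/4ᴺ.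
module Submission where

open import Algebra.Bundles using (module CommutativeRing)
open import Data.Empty using (⊥-elim)
open import Data.Fin.Base using (toℕ)
open import Data.Integer.Base as ℤ using (ℤ; +_; +[1+_]; -[1+_]; -1ℤ)
import Data.Integer.Divisibility as ℤ
open import Data.Integer.Divisibility.Signed as Signed using (∣ᵤ⇒∣; ∣⇒∣ᵤ)
import Data.Integer.Properties as ℤ
import Data.Integer.Tactic.RingSolver as ℤ
open import Data.Nat.Base as ℕ using (ℕ; zero; suc; NonZero; _!)
open import Data.Nat.Combinatorics using (_C_; nCk≡nC[n∸k]; nCk+nC[k+1]≡[n+1]C[k+1]; nC1≡n; nCn≡1; k>n⇒nCk≡0)
open import Data.Nat.Divisibility using (_∣_; _∣?_; divides; ∣⇒≤; ∣1⇒≡1; 1∣_; ∣-refl; ∣-trans; m∣m*n; *-monoʳ-∣; *-cancelˡ-∣; *-pres-∣)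
open import Data.Nat.DivMod using (m*n/n≡m)
open import Data.Nat.Primality using (Prime; prime?; euclidsLemma; ¬prime[0]; ¬prime[1]; prime⇒nonTrivial; prime⇒nonZero)
import Data.Nat.Properties as ℕ
import Data.Nat.Tactic.RingSolver as ℕ
open import Data.Product using (_×_; _,_; ∃-syntax)
open import Data.Rational.Base as ℚ using (ℚ; 1ℚ; 0ℚ; _+_; _*_; _-_; -_; mkℚ; toℚᵘ)
open import Data.Rational.Literals using (fromℤ)
import Data.Rational.Properties as ℚ
import Data.Rational.Unnormalised.Base as ℚᵘ
import Data.Rational.Unnormalised.Properties as ℚᵘ
open import Data.Sum.Base using (inj₁; inj₂; [_,_]′)
open import Function.Base using (_∘_)
open import Level using (0ℓ)
open import Relation.Binary.PropositionalEquality using (_≡_; _≢_; refl; sym; trans; cong; cong₂; subst; subst₂; module ≡-Reasoning)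
open import Relation.Nullary using (¬_; Dec; yes; no)
open import Relation.Nullary.Construct.Add.Supremum using (⊤⁺; [_])
open import Relation.Nullary.Decidable using (dec⇒maybe; from-yes; from-no)
import Relation.Binary.Construct.Add.Supremum.NonStrict ℤ._≤_ as Sup
open import Tactic.RingSolver using (solve-∀)
import Tactic.RingSolver.Core.AlmostCommutativeRing as ACR
open import Algebra.Definitions.RawSemiring ℚ.+-*-rawSemiring using (_^_)
open import Algebra.Properties.CommutativeMonoid.Sum ℚ.+-0-commutativeMonoid using (sum; sum-cong-≗)
open import Algebra.Properties.CommutativeSemiring.Exp (CommutativeRing.commutativeSemiring ℚ.+-*-commutativeRing) using (^-assocʳ; ^-distrib-*)
open import Defs

open ≡-Reasoning

-- As B(i,i) = ∫₀¹ xⁱ(1-x)ⁱ dx, the expansion says mᴺ S(n) = n c(N) ∫₀¹ (1 + t x(1-x))ᴺ dx. The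
-- bound 2i+1 < pⁱ leaves at most pⁱ⁻¹ in the denominator of B(i,i), so i - 1 of the i factors t pay
-- for it and one survives as the modulus. For p = 3 and i = 1 the bound would read 3 < 3: the term
-- is an integral multiple of t/6, of which only t/3 is sure to be a divisor. Both occurrences of δ
-- come from here. In S the term is kept and evaluated; in T a factor 3 of the modulus is given up
-- instead. Congruences are handled as membership in an ideal of the local ring, not through `ν`:
-- for m = 4 the modulus t is 0, its ideal is {0}, and equality comes out of the same argument.
-- Valuations enter only when the results are translated. The iterated difference `D` has integer
-- coefficients, hence respects every such ideal; this carries integrality and congruences from the
-- S(k+1)/(k+1) over to T(n)/n.

ring : ACR.AlmostCommutativeRing 0ℓ 0ℓ
ring = ACR.fromCommutativeRing ℚ.+-*-commutativeRing λ x → dec⇒maybe (0ℚ ℚ.≟ x)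

-- Integers and their inverses inside ℚ.

fromℤ-homo-+ : ∀ i j → fromℤ (i ℤ.+ j) ≡ fromℤ i + fromℤ j
fromℤ-homo-+ i j = ℚ.toℚᵘ-injective (ℚᵘ.≃-sym (ℚᵘ.≃-trans (ℚ.toℚᵘ-homo-+ (fromℤ i) (fromℤ j))
  (ℚᵘ.*≡* (cong (ℤ._* + 1) (cong₂ ℤ._+_ (ℤ.*-identityʳ i) (ℤ.*-identityʳ j))))))

fromℤ-homo-* : ∀ i j → fromℤ (i ℤ.* j) ≡ fromℤ i * fromℤ j
fromℤ-homo-* i j = ℚ.toℚᵘ-injective (ℚᵘ.≃-sym (ℚᵘ.≃-trans (ℚ.toℚᵘ-homo-* (fromℤ i) (fromℤ j)) (ℚᵘ.*≡* refl)))

fromℤ-homo‿- : ∀ i → fromℤ (ℤ.- i) ≡ - fromℤ i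
fromℤ-homo‿- (+ zero)  = refl
fromℤ-homo‿- +[1+ n ] = refl
fromℤ-homo‿- -[1+ n ] = refl

fromℤ-homo-^ : ∀ i k → fromℤ (i ℤ.^ k) ≡ fromℤ i ^ k
fromℤ-homo-^ i zero    = refl
fromℤ-homo-^ i (suc k) = trans (fromℤ-homo-* i (i ℤ.^ k)) (cong (fromℤ i *_) (fromℤ-homo-^ i k))

fromℤ-injective : ∀ {i j} → fromℤ i ≡ fromℤ j → i ≡ j
fromℤ-injective = cong ℚ.↥_

ι : ℕ → ℚ
ι n = fromℤ (+ n)

ι-+ : ∀ m n → ι (m ℕ.+ n) ≡ ι m + ι n
ι-+ m n = fromℤ-homo-+ (+ m) (+ n)

ι-* : ∀ m n → ι (m ℕ.* n) ≡ ι m * ι n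
ι-* m n = trans (cong fromℤ (ℤ.pos-* m n)) (fromℤ-homo-* (+ m) (+ n))

ι-suc : ∀ n → ι (suc n) ≡ 1ℚ + ι n
ι-suc = ι-+ 1

ι-^ : ∀ m k → ι (m ℕ.^ k) ≡ ι m ^ k
ι-^ m zero    = refl
ι-^ m (suc k) = trans (ι-* m (m ℕ.^ k)) (cong (ι m *_) (ι-^ m k))

/-* : ∀ i d .{{_ : NonZero d}} → (i ℚ./ d) * ι d ≡ fromℤ i
/-* i d@(suc d-1) = ℚ.toℚᵘ-injective (ℚᵘ.≃-trans (ℚ.toℚᵘ-homo-* (i ℚ./ d) (ι d))
  (ℚᵘ.≃-trans (ℚᵘ.*-congʳ {toℚᵘ (ι d)} (ℚ.toℚᵘ-fromℚᵘ (ℚᵘ.mkℚᵘ i d-1)))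
  (ℚᵘ.*≡* (trans (ℤ.*-identityʳ (i ℤ.* + d)) (cong (λ k → i ℤ.* + k) (sym (ℕ.*-identityʳ d)))))))

ι⁻¹ : (n : ℕ) → .{{NonZero n}} → ℚ
ι⁻¹ n = + 1 ℚ./ n

*-inverse-ι : ∀ n .{{_ : NonZero n}} → ι⁻¹ n * ι n ≡ 1ℚ
*-inverse-ι n = /-* (+ 1) n

*-cancelˡ-inverse : ∀ {x x⁻¹ y z} → x⁻¹ * x ≡ 1ℚ → x * y ≡ x * z → y ≡ z
*-cancelˡ-inverse {x} {x⁻¹} {y} {z} inv eq = trans (sym (lem y)) (trans (cong (x⁻¹ *_) eq) (lem z))
  where
  lem : ∀ y → x⁻¹ * (x * y) ≡ y
  lem y = trans (sym (ℚ.*-assoc x⁻¹ x y)) (trans (cong (_* y) inv) (ℚ.*-identityˡ y))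

*-cancelˡ-ι : ∀ n .{{_ : NonZero n}} {y z} → ι n * y ≡ ι n * z → y ≡ z
*-cancelˡ-ι n = *-cancelˡ-inverse {ι n} {ι⁻¹ n} (*-inverse-ι n)

-- Binomial coefficients

nC0≡1 : ∀ n → n C 0 ≡ 1
nC0≡1 n = trans (nCk≡nC[n∸k] {0} {n} ℕ.z≤n) (nCn≡1 n)

-- This is (k+1) C(n,k+1) = (n-k) C(n,k) without the truncated subtraction. The two identities are
-- proved together: Pascal's rule derives absorption at n from this one at n, and two uses of
-- absorption at n give this one at n + 1.
[k+1]*nC[k+1]+k*nCk≡n*nCk : ∀ n k → suc k ℕ.* (n C suc k) ℕ.+ k ℕ.* (n C k) ≡ n ℕ.* (n C k)
[k+1]*[n+1]C[k+1]≡[n+1]*nCk : ∀ n k → suc k ℕ.* (suc n C suc k) ≡ suc n ℕ.* (n C k)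

[k+1]*[n+1]C[k+1]≡[n+1]*nCk n k = begin
  suc k ℕ.* (suc n C suc k)                    ≡⟨ cong (suc k ℕ.*_) (nCk+nC[k+1]≡[n+1]C[k+1] n k) ⟨
  suc k ℕ.* (n C k ℕ.+ n C suc k)                ≡⟨ lem k (n C k) (n C suc k) ⟩
  n C k ℕ.+ (suc k ℕ.* (n C suc k) ℕ.+ k ℕ.* (n C k)) ≡⟨ cong (n C k ℕ.+_) ([k+1]*nC[k+1]+k*nCk≡n*nCk n k) ⟩
  suc n ℕ.* (n C k)                            ∎
  where
  lem : ∀ k x y → suc k ℕ.* (x ℕ.+ y) ≡ x ℕ.+ (suc k ℕ.* y ℕ.+ k ℕ.* x)
  lem = ℕ.solve-∀

[k+1]*nC[k+1]+k*nCk≡n*nCk zero zero = refl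
[k+1]*nC[k+1]+k*nCk≡n*nCk zero (suc k) = cong₂ ℕ._+_ (ℕ.*-zeroʳ k) (ℕ.*-zeroʳ k)
[k+1]*nC[k+1]+k*nCk≡n*nCk (suc n) zero = begin
  1 ℕ.* (suc n C 1) ℕ.+ 0 ≡⟨ lem (suc n C 1) ⟩
  suc n C 1               ≡⟨ nC1≡n (suc n) ⟩
  suc n                   ≡⟨ ℕ.*-identityʳ (suc n) ⟨
  suc n ℕ.* 1             ≡⟨ cong (suc n ℕ.*_) (nC0≡1 (suc n)) ⟨
  suc n ℕ.* (suc n C 0)   ∎
  where
  lem : ∀ x → 1 ℕ.* x ℕ.+ 0 ≡ x
  lem = ℕ.solve-∀
[k+1]*nC[k+1]+k*nCk≡n*nCk (suc n) (suc k) = begin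
  suc (suc k) ℕ.* (suc n C suc (suc k)) ℕ.+ suc k ℕ.* (suc n C suc k)
    ≡⟨ cong₂ ℕ._+_ ([k+1]*[n+1]C[k+1]≡[n+1]*nCk n (suc k)) ([k+1]*[n+1]C[k+1]≡[n+1]*nCk n k) ⟩
  suc n ℕ.* (n C suc k) ℕ.+ suc n ℕ.* (n C k)
    ≡⟨ lem n (n C suc k) (n C k) ⟩
  suc n ℕ.* (n C k ℕ.+ n C suc k)
    ≡⟨ cong (suc n ℕ.*_) (nCk+nC[k+1]≡[n+1]C[k+1] n k) ⟩
  suc n ℕ.* (suc n C suc k) ∎
  where
  lem : ∀ n x y → suc n ℕ.* x ℕ.+ suc n ℕ.* y ≡ suc n ℕ.* (y ℕ.+ x)
  lem = ℕ.solve-∀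

binom : ℕ → ℕ → ℚ
binom n k = ι (n C k)

binom-zero : ∀ n → binom n 0 ≡ 1ℚ
binom-zero n = cong ι (nC0≡1 n)

binom-pascal : ∀ n k → binom (suc n) (suc k) ≡ binom n k + binom n (suc k)
binom-pascal n k = trans (cong ι (sym (nCk+nC[k+1]≡[n+1]C[k+1] n k))) (ι-+ (n C k) (n C suc k))

binom-absorb : ∀ n k → ι (suc k) * binom (suc n) (suc k) ≡ ι (suc n) * binom n k
binom-absorb n k = begin
  ι (suc k) * binom (suc n) (suc k)  ≡⟨ ι-* (suc k) (suc n C suc k) ⟨
  ι (suc k ℕ.* (suc n C suc k))      ≡⟨ cong ι ([k+1]*[n+1]C[k+1]≡[n+1]*nCk n k) ⟩
  ι (suc n ℕ.* (n C k))              ≡⟨ ι-* (suc n) (n C k) ⟩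
  ι (suc n) * binom n k              ∎

binom-next : ∀ n k → ι (suc k) * binom n (suc k) ≡ (ι n - ι k) * binom n k
binom-next n k = begin
  ι (suc k) * binom n (suc k)                        ≡⟨ lem₁ (ι (suc k) * binom n (suc k)) (ι k * binom n k) ⟩
  (ι (suc k) * binom n (suc k) + ι k * binom n k) - ι k * binom n k ≡⟨ cong (_- ι k * binom n k) eq ⟩
  ι n * binom n k - ι k * binom n k                  ≡⟨ lem₂ (ι n) (ι k) (binom n k) ⟩
  (ι n - ι k) * binom n k                            ∎
  where
  lem₁ : ∀ x y → x ≡ (x + y) - y
  lem₁ = solve-∀ ring
  lem₂ : ∀ x y z → x * z - y * z ≡ (x - y) * z
  lem₂ = solve-∀ ring
  eq : ι (suc k) * binom n (suc k) + ι k * binom n k ≡ ι n * binom n k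
  eq = begin
    ι (suc k) * binom n (suc k) + ι k * binom n k ≡⟨ cong₂ _+_ (ι-* (suc k) (n C suc k)) (ι-* k (n C k)) ⟨
    ι (suc k ℕ.* (n C suc k)) + ι (k ℕ.* (n C k)) ≡⟨ ι-+ (suc k ℕ.* (n C suc k)) (k ℕ.* (n C k)) ⟨
    ι (suc k ℕ.* (n C suc k) ℕ.+ k ℕ.* (n C k))   ≡⟨ cong ι ([k+1]*nC[k+1]+k*nCk≡n*nCk n k) ⟩
    ι (n ℕ.* (n C k))                             ≡⟨ ι-* n (n C k) ⟩
    ι n * binom n k                               ∎

-- Central binomial coefficients and their recurrences.

cb : ℕ → ℚ
cb k = binom (2 ℕ.* k) k

-- c (n - 1) is the binomial coefficient (2n-1 choose n-1) of the theorem.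
c : ℕ → ℚ
c n = binom (suc (2 ℕ.* n)) n

c-sym : ∀ n → c n ≡ binom (suc (2 ℕ.* n)) (suc n)
c-sym n = cong ι (trans (nCk≡nC[n∸k] {n} (ℕ.m≤n⇒m≤1+n (ℕ.m≤m+n n (n ℕ.+ 0))))
  (cong (suc (2 ℕ.* n) C_) (trans (ℕ.+-∸-assoc 1 (ℕ.m≤m+n n (n ℕ.+ 0))) (cong suc (trans (ℕ.m+n∸m≡n n (n ℕ.+ 0)) (ℕ.+-identityʳ n))))))

2*suc : ∀ n → 2 ℕ.* suc n ≡ suc (suc (2 ℕ.* n))
2*suc = ℕ.solve-∀

cb-suc : ∀ n → cb (suc n) ≡ ι 2 * c n
cb-suc n = begin
  cb (suc n)                                      ≡⟨ cong (λ m → binom m (suc n)) (2*suc n) ⟩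
  binom (suc (suc (2 ℕ.* n))) (suc n)             ≡⟨ binom-pascal (suc (2 ℕ.* n)) n ⟩
  c n + binom (suc (2 ℕ.* n)) (suc n)             ≡⟨ cong (_+_ (c n)) (c-sym n) ⟨
  c n + c n                                       ≡⟨ lem (c n) ⟩
  ι 2 * c n                                       ∎
  where
  lem : ∀ x → x + x ≡ ι 2 * x
  lem = solve-∀ ring

ι-1+2* : ∀ n → ι (suc (2 ℕ.* n)) ≡ 1ℚ + ι 2 * ι n
ι-1+2* n = trans (ι-suc (2 ℕ.* n)) (cong (_+_ 1ℚ) (ι-* 2 n))

c-cb : ∀ n → ι (suc n) * c n ≡ (1ℚ + ι 2 * ι n) * cb n
c-cb n = begin
  ι (suc n) * c n                             ≡⟨ cong (ι (suc n) *_) (c-sym n) ⟩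
  ι (suc n) * binom (suc (2 ℕ.* n)) (suc n)   ≡⟨ binom-absorb (2 ℕ.* n) n ⟩
  ι (suc (2 ℕ.* n)) * cb n                    ≡⟨ cong (_* cb n) (ι-1+2* n) ⟩
  (1ℚ + ι 2 * ι n) * cb n                     ∎

cb-rec : ∀ n → ι (suc n) * cb (suc n) ≡ ι 2 * (1ℚ + ι 2 * ι n) * cb n
cb-rec n = begin
  ι (suc n) * cb (suc n)         ≡⟨ cong (ι (suc n) *_) (cb-suc n) ⟩
  ι (suc n) * (ι 2 * c n)        ≡⟨ lem (ι (suc n)) (c n) ⟩
  ι 2 * (ι (suc n) * c n)        ≡⟨ cong (ι 2 *_) (c-cb n) ⟩
  ι 2 * ((1ℚ + ι 2 * ι n) * cb n) ≡⟨ ℚ.*-assoc (ι 2) (1ℚ + ι 2 * ι n) (cb n) ⟨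
  ι 2 * (1ℚ + ι 2 * ι n) * cb n  ∎
  where
  lem : ∀ x y → x * (ι 2 * y) ≡ ι 2 * (x * y)
  lem = solve-∀ ring

c-rec : ∀ n → ι (suc (suc n)) * c (suc n) ≡ ι 2 * (1ℚ + ι 2 * ι (suc n)) * c n
c-rec n = begin
  ι (suc (suc n)) * c (suc n)            ≡⟨ c-cb (suc n) ⟩
  (1ℚ + ι 2 * ι (suc n)) * cb (suc n)    ≡⟨ cong ((1ℚ + ι 2 * ι (suc n)) *_) (cb-suc n) ⟩
  (1ℚ + ι 2 * ι (suc n)) * (ι 2 * c n)   ≡⟨ lem (ι (suc n)) (c n) ⟩
  ι 2 * (1ℚ + ι 2 * ι (suc n)) * c n     ∎
  where
  lem : ∀ x y → (1ℚ + ι 2 * x) * (ι 2 * y) ≡ ι 2 * (1ℚ + ι 2 * x) * y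
  lem = solve-∀ ring

-- Finite sums and iterated differences

∑< : ℕ → (ℕ → ℚ) → ℚ
∑< n f = sum {n} (λ k → f (toℕ k))

∑-cong : ∀ n {f g : ℕ → ℚ} → (∀ k → f k ≡ g k) → ∑< n f ≡ ∑< n g
∑-cong n f≗g = sum-cong-≗ {n} (λ k → f≗g (toℕ k))

∑-last : ∀ n f → ∑< (suc n) f ≡ ∑< n f + f n
∑-last zero f = ℚ.+-comm (f 0) 0ℚ
∑-last (suc n) f = begin
  f 0 + ∑< (suc n) (f ∘ suc)           ≡⟨ cong (_+_ (f 0)) (∑-last n (f ∘ suc)) ⟩
  f 0 + (∑< n (f ∘ suc) + f (suc n))   ≡⟨ ℚ.+-assoc (f 0) _ _ ⟨
  f 0 + ∑< n (f ∘ suc) + f (suc n)     ∎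

-- With `v = 0ℚ` this also serves for scaling; `h` is given only pointwise, so that no function
-- extensionality is called for.
∑-linear : ∀ n f g {h : ℕ → ℚ} u v → (∀ k → h k ≡ u * f k + v * g k) → ∑< n h ≡ u * ∑< n f + v * ∑< n g
∑-linear zero f g u v eq = lem u v
  where
  lem : ∀ u v → 0ℚ ≡ u * 0ℚ + v * 0ℚ
  lem = solve-∀ ring
∑-linear (suc n) f g {h} u v eq = begin
  h 0 + ∑< n (h ∘ suc)
    ≡⟨ cong₂ _+_ (eq 0) (∑-linear n (f ∘ suc) (g ∘ suc) u v (eq ∘ suc)) ⟩
  (u * f 0 + v * g 0) + (u * ∑< n (f ∘ suc) + v * ∑< n (g ∘ suc))
    ≡⟨ lem u v (f 0) (g 0) (∑< n (f ∘ suc)) (∑< n (g ∘ suc)) ⟩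
  u * (f 0 + ∑< n (f ∘ suc)) + v * (g 0 + ∑< n (g ∘ suc)) ∎
  where
  lem : ∀ u v a b x y → (u * a + v * b) + (u * x + v * y) ≡ u * (a + x) + v * (b + y)
  lem = solve-∀ ring

-- h! n is a rising factorial of ½, so that h! n * g! n = C(2n,n) / 4ⁿ; see cb-h!g!.
f! g! h! : ℕ → ℚ
f! n = ι (n !)
g! zero    = 1ℚ
g! (suc n) = ι⁻¹ (suc n) * g! n
h! zero    = 1ℚ
h! (suc n) = (ℚ.½ + ι n) * h! n

f!-suc : ∀ n → f! (suc n) ≡ ι (suc n) * f! n
f!-suc n = ι-* (suc n) (n !)

g!-suc : ∀ n → ι (suc n) * g! (suc n) ≡ g! n
g!-suc n = begin
  ι (suc n) * (ι⁻¹ (suc n) * g! n) ≡⟨ lem (ι (suc n)) (ι⁻¹ (suc n)) (g! n) ⟩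
  (ι⁻¹ (suc n) * ι (suc n)) * g! n ≡⟨ cong (_* g! n) (*-inverse-ι (suc n)) ⟩
  1ℚ * g! n                        ≡⟨ ℚ.*-identityˡ (g! n) ⟩
  g! n                             ∎
  where
  lem : ∀ x y z → x * (y * z) ≡ (y * x) * z
  lem = solve-∀ ring

-- The Beta integral ∫₀¹ xⁱ (1 - x)ʲ dx: expanding (1 - x)ʲ shows that its denominators are
-- those of the fractions 1 / r with r ≤ i + j + 1.
β : ℕ → ℕ → ℚ
β i j = f! i * f! j * g! (suc (i ℕ.+ j))

-- Under the integral this is (1-x)ʲ⁺¹ = (1-x)ʲ - x(1-x)ʲ; on factorials it amounts to i+j+2 = (i+1)
-- + (j+1).
β-suc : ∀ i j → β i (suc j) ≡ β i j - β (suc i) j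
β-suc i j = begin
  f! i * f! (suc j) * g! (suc (i ℕ.+ suc j))
    ≡⟨ cong₂ (λ x y → f! i * x * g! (suc y)) (f!-suc j) (ℕ.+-suc i j) ⟩
  f! i * (ι (suc j) * f! j) * g! (suc (suc s))
    ≡⟨ cong (λ x → f! i * (x * f! j) * g! (suc (suc s))) (ι-suc j) ⟩
  f! i * ((1ℚ + ι j) * f! j) * g! (suc (suc s))
    ≡⟨ lem (ι i) (ι j) (f! i) (f! j) (g! (suc (suc s))) ⟩
  f! i * f! j * ((1ℚ + (1ℚ + (ι i + ι j))) * g! (suc (suc s))) - (1ℚ + ι i) * f! i * f! j * g! (suc (suc s))
    ≡⟨ cong₂ (λ x y → f! i * f! j * (x * g! (suc (suc s))) - y * f! i * f! j * g! (suc (suc s))) eq (ι-suc i) ⟨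
  f! i * f! j * (ι (suc (suc s)) * g! (suc (suc s))) - ι (suc i) * f! i * f! j * g! (suc (suc s))
    ≡⟨ cong₂ (λ x y → f! i * f! j * x - y * f! j * g! (suc (suc s))) (g!-suc (suc s)) (sym (f!-suc i)) ⟩
  f! i * f! j * g! (suc s) - f! (suc i) * f! j * g! (suc (suc s)) ∎
  where
  s = i ℕ.+ j
  eq : ι (suc (suc s)) ≡ 1ℚ + (1ℚ + (ι i + ι j))
  eq = trans (ι-suc (suc s)) (cong (_+_ 1ℚ) (trans (ι-suc s) (cong (_+_ 1ℚ) (ι-+ i j))))
  lem : ∀ i j x y z → x * ((1ℚ + j) * y) * z ≡ x * y * ((1ℚ + (1ℚ + (i + j))) * z) - (1ℚ + i) * x * y * z
  lem = solve-∀ ring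

β-zeroʳ : ∀ i → ι (suc i) * β i 0 ≡ 1ℚ
β-zeroʳ i = begin
  ι (suc i) * (f! i * 1ℚ * g! (suc (i ℕ.+ 0))) ≡⟨ cong (λ x → ι (suc i) * (f! i * 1ℚ * g! (suc x))) (ℕ.+-identityʳ i) ⟩
  ι (suc i) * (f! i * 1ℚ * g! (suc i))         ≡⟨ lem (ι (suc i)) (f! i) (g! (suc i)) ⟩
  f! i * (ι (suc i) * g! (suc i))              ≡⟨ cong (f! i *_) (g!-suc i) ⟩
  f! i * g! i                                  ≡⟨ f!*g! i ⟩
  1ℚ                                           ∎
  where
  lem : ∀ x y z → x * (y * 1ℚ * z) ≡ y * (x * z)
  lem = solve-∀ ring
  f!*g! : ∀ n → f! n * g! n ≡ 1ℚ
  f!*g! zero = refl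
  f!*g! (suc n) = begin
    f! (suc n) * g! (suc n)          ≡⟨ cong (_* g! (suc n)) (f!-suc n) ⟩
    ι (suc n) * f! n * g! (suc n)    ≡⟨ lem′ (ι (suc n)) (f! n) (g! (suc n)) ⟩
    f! n * (ι (suc n) * g! (suc n))  ≡⟨ cong (f! n *_) (g!-suc n) ⟩
    f! n * g! n                      ≡⟨ f!*g! n ⟩
    1ℚ                               ∎
    where
    lem′ : ∀ x y z → x * y * z ≡ y * (x * z)
    lem′ = solve-∀ ring

-- The ratio of consecutive diagonal values is (i+1)² / ((2i+2)(2i+3)), with a factor i + 1
-- cancelled.
β-diag : ∀ i → ι 2 * (ι 2 * ι i + ι 3) * β (suc i) (suc i) ≡ ι (suc i) * β i i
β-diag i = begin
  ι 2 * (ι 2 * ι i + ι 3) * (f! (suc i) * f! (suc i) * g! (suc (suc i ℕ.+ suc i)))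
    ≡⟨ cong₂ (λ x k → ι 2 * (ι 2 * ι i + ι 3) * (x * x * g! (suc (suc k)))) (f!-suc i) (ℕ.+-suc i i) ⟩
  ι 2 * (ι 2 * ι i + ι 3) * ((ι (suc i) * f! i) * (ι (suc i) * f! i) * g! (3 ℕ.+ s))
    ≡⟨ lem (ι i) (ι (suc i)) (f! i) (g! (3 ℕ.+ s)) ⟩
  f! i * f! i * ι (suc i) * (ι 2 * ι (suc i) * ((ι 2 * ι i + ι 3) * g! (3 ℕ.+ s)))
    ≡⟨ cong₂ (λ x y → f! i * f! i * ι (suc i) * (x * (y * g! (3 ℕ.+ s)))) eq₂ eq₃ ⟨
  f! i * f! i * ι (suc i) * (ι (2 ℕ.+ s) * (ι (3 ℕ.+ s) * g! (3 ℕ.+ s)))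
    ≡⟨ cong (λ x → f! i * f! i * ι (suc i) * (ι (2 ℕ.+ s) * x)) (g!-suc (2 ℕ.+ s)) ⟩
  f! i * f! i * ι (suc i) * (ι (2 ℕ.+ s) * g! (2 ℕ.+ s))
    ≡⟨ cong (f! i * f! i * ι (suc i) *_) (g!-suc (suc s)) ⟩
  f! i * f! i * ι (suc i) * g! (suc s)
    ≡⟨ lem′ (f! i) (ι (suc i)) (g! (suc s)) ⟩
  ι (suc i) * (f! i * f! i * g! (suc s)) ∎
  where
  s = i ℕ.+ i
  lem : ∀ i j x z → ι 2 * (ι 2 * i + ι 3) * ((j * x) * (j * x) * z) ≡ x * x * j * (ι 2 * j * ((ι 2 * i + ι 3) * z))
  lem = solve-∀ ring
  lem′ : ∀ x y z → x * x * y * z ≡ y * (x * x * z)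
  lem′ = solve-∀ ring
  two : ∀ x → ι 2 + (x + x) ≡ ι 2 * (1ℚ + x)
  two = solve-∀ ring
  three : ∀ x → ι 3 + (x + x) ≡ ι 2 * x + ι 3
  three = solve-∀ ring
  eq₂ : ι (2 ℕ.+ s) ≡ ι 2 * ι (suc i)
  eq₂ = trans (ι-+ 2 s) (trans (cong (_+_ (ι 2)) (ι-+ i i)) (trans (two (ι i)) (cong (ι 2 *_) (sym (ι-suc i)))))
  eq₃ : ι (3 ℕ.+ s) ≡ ι 2 * ι i + ι 3
  eq₃ = trans (ι-+ 3 s) (trans (cong (_+_ (ι 3)) (ι-+ i i)) (three (ι i)))

-- D n f k = ∑ⱼ C(n,j) (-1)ʲ f (k + j)
D : ℕ → (ℕ → ℚ) → ℕ → ℚ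
D zero    f k = f k
D (suc n) f k = D n f k - D n f (suc k)

D-cong : ∀ n {f g} → (∀ k → f k ≡ g k) → ∀ k → D n f k ≡ D n g k
D-cong zero    eq k = eq k
D-cong (suc n) eq k = cong₂ _-_ (D-cong n eq k) (D-cong n eq (suc k))

D-shift : ∀ n f k → D n f (suc k) ≡ D n (f ∘ suc) k
D-shift zero f k = refl
D-shift (suc n) f k = cong₂ _-_ (D-shift n f k) (D-shift n f (suc k))

D-suc : ∀ n f k → D (suc n) f k ≡ D n (λ j → f j - f (suc j)) k
D-suc zero f k = refl
D-suc (suc n) f k = cong₂ _-_ (D-suc n f k) (D-suc n f (suc k))

D-neg : ∀ n f k → D n (λ j → - f j) k ≡ - D n f k
D-neg zero f k = refl
D-neg (suc n) f k = trans (cong₂ _-_ (D-neg n f k) (D-neg n f (suc k))) (lem (D n f k) (D n f (suc k)))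
  where
  lem : ∀ a b → - a - - b ≡ - (a - b)
  lem = solve-∀ ring

D-homo-- : ∀ n f g k → D n (λ j → f j - g j) k ≡ D n f k - D n g k
D-homo-- zero f g k = refl
D-homo-- (suc n) f g k = trans (cong₂ _-_ (D-homo-- n f g k) (D-homo-- n f g (suc k)))
  (lem (D n f k) (D n g k) (D n f (suc k)) (D n g (suc k)))
  where
  lem : ∀ a b c d → (a - b) - (c - d) ≡ (a - c) - (b - d)
  lem = solve-∀ ring

-- With E the shift, `D n` is (1-E)ⁿ. Since E j = (j+1) E, the commutator of (1-E)ⁿ⁺¹ with
-- multiplication by j is -(n+1) E (1-E)ⁿ.
D-leibniz : ∀ n f k → D (suc n) (λ j → ι j * f j) k ≡ ι k * D (suc n) f k - ι (suc n) * D n f (suc k)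
D-leibniz zero f k = trans (cong (λ x → ι k * f k - x * f (suc k)) (ι-suc k)) (lem (ι k) (f k) (f (suc k)))
  where
  lem : ∀ x a b → x * a - (1ℚ + x) * b ≡ x * (a - b) - 1ℚ * b
  lem = solve-∀ ring
D-leibniz (suc n) f k = begin
  D (suc n) (λ j → ι j * f j) k - D (suc n) (λ j → ι j * f j) (suc k)
    ≡⟨ cong₂ _-_ (D-leibniz n f k) (D-leibniz n f (suc k)) ⟩
  (ι k * x - ι (suc n) * (D n f (suc k))) - (ι (suc k) * y - ι (suc n) * D n f (suc (suc k)))
    ≡⟨ cong (λ z → (ι k * x - ι (suc n) * (D n f (suc k))) - (z * y - ι (suc n) * D n f (suc (suc k)))) (ι-suc k) ⟩
  (ι k * x - ι (suc n) * (D n f (suc k))) - ((1ℚ + ι k) * y - ι (suc n) * D n f (suc (suc k)))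
    ≡⟨ lem (ι k) (ι (suc n)) x (D n f (suc k)) (D n f (suc (suc k))) ⟩
  ι k * (x - y) - (1ℚ + ι (suc n)) * y
    ≡⟨ cong (λ z → ι k * (x - y) - z * y) (ι-suc (suc n)) ⟨
  ι k * (x - y) - ι (suc (suc n)) * y ∎
  where
  x = D (suc n) f k
  y = D (suc n) f (suc k)
  lem : ∀ k n x c d → (k * x - n * c) - ((1ℚ + k) * (c - d) - n * d) ≡ k * (x - (c - d)) - (1ℚ + n) * (c - d)
  lem = solve-∀ ring

-1ℚ : ℚ
-1ℚ = fromℤ -1ℤ

∑-binom-D : ∀ n f → ∑< (suc n) (λ k → binom n k * -1ℚ ^ k * f k) ≡ D n f 0
∑-binom-D zero f = lem (f 0)
  where
  lem : ∀ x → 1ℚ * 1ℚ * x + 0ℚ ≡ x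
  lem = solve-∀ ring
∑-binom-D (suc n) f = begin
  binom (suc n) 0 * 1ℚ * f 0 + ∑< (suc n) (λ k → binom (suc n) (suc k) * (-1ℚ * -1ℚ ^ k) * f (suc k))
    ≡⟨ cong (λ x → x * 1ℚ * f 0 + ∑< (suc n) (λ k → binom (suc n) (suc k) * (-1ℚ * -1ℚ ^ k) * f (suc k))) (trans (binom-zero (suc n)) (sym (binom-zero n))) ⟩
  binom n 0 * 1ℚ * f 0 + ∑< (suc n) (λ k → binom (suc n) (suc k) * (-1ℚ * -1ℚ ^ k) * f (suc k))
    ≡⟨ cong (_+_ (binom n 0 * 1ℚ * f 0)) (∑-linear (suc n) (λ k → binom n k * -1ℚ ^ k * f (suc k)) (summand ∘ suc) -1ℚ 1ℚ (λ k → trans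
         (cong (λ x → x * (-1ℚ * -1ℚ ^ k) * f (suc k)) (binom-pascal n k))
         (lem (binom n k) (binom n (suc k)) (-1ℚ ^ k) (f (suc k))))) ⟩
  summand 0 + (-1ℚ * ∑< (suc n) (λ k → binom n k * -1ℚ ^ k * f (suc k)) + 1ℚ * ∑< (suc n) (summand ∘ suc))
    ≡⟨ lem₂ (summand 0) (∑< (suc n) (λ k → binom n k * -1ℚ ^ k * f (suc k))) (∑< (suc n) (summand ∘ suc)) ⟩
  ∑< (suc (suc n)) summand - ∑< (suc n) (λ k → binom n k * -1ℚ ^ k * f (suc k))
    ≡⟨ cong₂ _-_ (∑-last (suc n) summand) (∑-binom-D n (f ∘ suc)) ⟩
  ∑< (suc n) summand + binom n (suc n) * -1ℚ ^ suc n * f (suc n) - D n (f ∘ suc) 0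
    ≡⟨ cong₂ (λ x y → x + y * -1ℚ ^ suc n * f (suc n) - D n (f ∘ suc) 0) (∑-binom-D n f) (cong ι (k>n⇒nCk≡0 (ℕ.n<1+n n))) ⟩
  D n f 0 + 0ℚ * -1ℚ ^ suc n * f (suc n) - D n (f ∘ suc) 0
    ≡⟨ cong₂ (λ x y → D n f 0 + x - y) (lem₃ (-1ℚ ^ suc n) (f (suc n))) (sym (D-shift n f 0)) ⟩
  D n f 0 + 0ℚ - D n f 1
    ≡⟨ cong (_- D n f 1) (ℚ.+-identityʳ (D n f 0)) ⟩
  D n f 0 - D n f 1 ∎
  where
  summand : ℕ → ℚ
  summand k = binom n k * -1ℚ ^ k * f k
  lem : ∀ a b s x → (a + b) * (-1ℚ * s) * x ≡ -1ℚ * (a * s * x) + 1ℚ * (b * (-1ℚ * s) * x)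
  lem = solve-∀ ring
  lem₂ : ∀ a b c → a + (-1ℚ * b + 1ℚ * c) ≡ (a + c) - b
  lem₂ = solve-∀ ring
  lem₃ : ∀ a b → 0ℚ * a * b ≡ 0ℚ
  lem₃ = solve-∀ ring


-- Summation by parts: - f k is the difference at k of the sequence k r(k-1), so the n-th difference
-- of f is an (n+1)-st difference of that product. In `D-leibniz` at index 0 only the term with the
-- factor n + 1 survives.
D-partial-sums : ∀ n f r → (∀ k → ι (suc k) * r k ≡ ∑< (suc k) f) → D n f 0 ≡ ι (suc n) * D n r 0
D-partial-sums n f r eq = begin
  D n f 0                             ≡⟨ neg-neg (D n f 0) ⟩
  - (- D n f 0)                       ≡⟨ cong -_ (D-neg n f 0) ⟨
  - D n (λ k → - f k) 0               ≡⟨ cong -_ (D-cong n step 0) ⟩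
  - D n (λ k → ι k * r₊ k - ι (suc k) * r k) 0  ≡⟨ cong -_ (D-suc n (λ k → ι k * r₊ k) 0) ⟨
  - D (suc n) (λ k → ι k * r₊ k) 0    ≡⟨ cong -_ (D-leibniz n r₊ 0) ⟩
  - (0ℚ * D (suc n) r₊ 0 - ι (suc n) * D n r₊ 1) ≡⟨ lem₀ (D (suc n) r₊ 0) (ι (suc n)) (D n r₊ 1) ⟩
  ι (suc n) * D n r₊ 1                ≡⟨ cong (ι (suc n) *_) (D-shift n r₊ 0) ⟩
  ι (suc n) * D n r 0                 ∎
  where
  r₊ : ℕ → ℚ
  -- A default value: it enters only multiplied by the index 0.
  r₊ zero    = 0ℚ
  r₊ (suc k) = r k
  neg-neg : ∀ x → x ≡ - (- x)
  neg-neg = solve-∀ ring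
  lem₀ : ∀ x n y → - (0ℚ * x - n * y) ≡ n * y
  lem₀ = solve-∀ ring
  lem : ∀ s x → - x ≡ s - (s + x)
  lem = solve-∀ ring
  partial : ∀ k → ι k * r₊ k ≡ ∑< k f
  partial zero    = refl
  partial (suc k) = eq k
  step : ∀ k → - f k ≡ ι k * r₊ k - ι (suc k) * r k
  step k = begin
    - f k                            ≡⟨ lem (∑< k f) (f k) ⟩
    ∑< k f - (∑< k f + f k)          ≡⟨ cong (_-_ (∑< k f)) (∑-last k f) ⟨
    ∑< k f - ∑< (suc k) f            ≡⟨ cong₂ _-_ (partial k) (eq k) ⟨
    ι k * r₊ k - ι (suc k) * r k     ∎

-- Up to the factor 1/π, the sequence consists of the moments ∫₀¹ xʲ x^(-½) (1-x)^(-½) dx. The n-th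
-- difference inserts (1-x)ⁿ, which gives B(k+½, n+½)/π. The induction step is (n+k+1) - (½+k) =
-- ½+n.
D-moments : ∀ n k → D n (λ j → h! j * g! j) k ≡ h! k * h! n * g! (n ℕ.+ k)
D-moments zero k = lem (h! k) (g! k)
  where
  lem : ∀ x y → x * y ≡ x * 1ℚ * y
  lem = solve-∀ ring
D-moments (suc n) k = begin
  D n (λ j → h! j * g! j) k - D n (λ j → h! j * g! j) (suc k)
    ≡⟨ cong₂ _-_ (D-moments n k) (D-moments n (suc k)) ⟩
  h! k * h! n * g! s - h! (suc k) * h! n * g! (n ℕ.+ suc k)
    ≡⟨ cong₂ (λ x j → h! k * h! n * x - h! (suc k) * h! n * g! j) (sym (g!-suc s)) (ℕ.+-suc n k) ⟩
  h! k * h! n * (ι (suc s) * g! (suc s)) - (ℚ.½ + ι k) * h! k * h! n * g! (suc s)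
    ≡⟨ cong (λ x → h! k * h! n * (x * g! (suc s)) - (ℚ.½ + ι k) * h! k * h! n * g! (suc s)) (trans (ι-suc s) (cong (_+_ 1ℚ) (ι-+ n k))) ⟩
  h! k * h! n * ((1ℚ + (ι n + ι k)) * g! (suc s)) - (ℚ.½ + ι k) * h! k * h! n * g! (suc s)
    ≡⟨ lem (ι n) (ι k) (h! n) (h! k) (g! (suc s)) ⟩
  h! k * ((ℚ.½ + ι n) * h! n) * g! (suc s) ∎
  where
  s = n ℕ.+ k
  lem : ∀ n k x y z → y * x * ((1ℚ + (n + k)) * z) - (ℚ.½ + k) * y * x * z ≡ y * ((ℚ.½ + n) * x) * z
  lem = solve-∀ ring

¼ : ℚ
¼ = ι⁻¹ 4

cb-h!g! : ∀ n → cb n * ¼ ^ n ≡ h! n * g! n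
cb-h!g! zero = refl
cb-h!g! (suc n) = *-cancelˡ-ι (suc n) (begin
  ι (suc n) * (cb (suc n) * (¼ * ¼ ^ n))         ≡⟨ lem₁ (ι (suc n)) (cb (suc n)) (¼ ^ n) ⟩
  (ι (suc n) * cb (suc n)) * (¼ * ¼ ^ n)         ≡⟨ cong (_* (¼ * ¼ ^ n)) (cb-rec n) ⟩
  ι 2 * (1ℚ + ι 2 * ι n) * cb n * (¼ * ¼ ^ n)    ≡⟨ lem₂ (ι n) (cb n) (¼ ^ n) ⟩
  (ℚ.½ + ι n) * (cb n * ¼ ^ n)                   ≡⟨ cong ((ℚ.½ + ι n) *_) (cb-h!g! n) ⟩
  (ℚ.½ + ι n) * (h! n * g! n)                    ≡⟨ cong (λ x → (ℚ.½ + ι n) * (h! n * x)) (g!-suc n) ⟨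
  (ℚ.½ + ι n) * (h! n * (ι (suc n) * g! (suc n))) ≡⟨ lem₃ (ι n) (h! n) (ι (suc n)) (g! (suc n)) ⟩
  ι (suc n) * ((ℚ.½ + ι n) * h! n * g! (suc n))  ∎)
  where
  lem₁ : ∀ x y z → x * (y * (¼ * z)) ≡ (x * y) * (¼ * z)
  lem₁ = solve-∀ ring
  lem₂ : ∀ n x y → ι 2 * (1ℚ + ι 2 * n) * x * (¼ * y) ≡ (ℚ.½ + n) * (x * y)
  lem₂ = solve-∀ ring
  lem₃ : ∀ n x y z → (ℚ.½ + n) * (x * (y * z)) ≡ y * ((ℚ.½ + n) * x * z)
  lem₃ = solve-∀ ring

-- The formula of `D-moments` is symmetric in n and k, so at k = 0 the alternating binomial
-- transform returns the sequence itself.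
D-cb : ∀ n → D n (λ k → cb k * ¼ ^ k) 0 ≡ cb n * ¼ ^ n
D-cb n = begin
  D n (λ k → cb k * ¼ ^ k) 0   ≡⟨ D-cong n cb-h!g! 0 ⟩
  D n (λ k → h! k * g! k) 0    ≡⟨ D-moments n 0 ⟩
  1ℚ * h! n * g! (n ℕ.+ 0)     ≡⟨ cong₂ (λ x k → x * g! k) (ℚ.*-identityˡ (h! n)) (ℕ.+-identityʳ n) ⟩
  h! n * g! n                  ≡⟨ cb-h!g! n ⟨
  cb n * ¼ ^ n                 ∎

-- One Horner step for (n+1) c(n) = ∑ₖ 4ⁿ⁻ᵏ C(2k,k). It settles the case m = 4 and the constant
-- coefficient of the general expansion.
c-step : ∀ n → ι (suc (suc n)) * c (suc n) ≡ ι 4 * (ι (suc n) * c n) + cb (suc n)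
c-step n = begin
  ι (suc (suc n)) * c (suc n)              ≡⟨ c-rec n ⟩
  ι 2 * (1ℚ + ι 2 * ι (suc n)) * c n       ≡⟨ lem (ι (suc n)) (c n) ⟩
  ι 4 * (ι (suc n) * c n) + ι 2 * c n      ≡⟨ cong (_+_ (ι 4 * (ι (suc n) * c n))) (cb-suc n) ⟨
  ι 4 * (ι (suc n) * c n) + cb (suc n)     ∎
  where
  lem : ∀ n x → ι 2 * (1ℚ + ι 2 * n) * x ≡ ι 4 * (n * x) + ι 2 * x
  lem = solve-∀ ring

∑-cb-¼ : ∀ n → ι (suc n) * (c n * ¼ ^ n) ≡ ∑< (suc n) (λ k → cb k * ¼ ^ k)
∑-cb-¼ zero = refl
∑-cb-¼ (suc n) = begin
  ι (suc (suc n)) * (c (suc n) * (¼ * ¼ ^ n))          ≡⟨ lem₁ (ι (suc (suc n))) (c (suc n)) (¼ ^ n) ⟩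
  (ι (suc (suc n)) * c (suc n)) * (¼ * ¼ ^ n)          ≡⟨ cong (_* (¼ * ¼ ^ n)) (c-step n) ⟩
  (ι 4 * (ι (suc n) * c n) + cb (suc n)) * (¼ * ¼ ^ n) ≡⟨ lem₂ (ι (suc n)) (c n) (cb (suc n)) (¼ ^ n) ⟩
  ι (suc n) * (c n * ¼ ^ n) + cb (suc n) * (¼ * ¼ ^ n) ≡⟨ cong (_+ cb (suc n) * ¼ ^ suc n) (∑-cb-¼ n) ⟩
  ∑< (suc n) (λ k → cb k * ¼ ^ k) + cb (suc n) * ¼ ^ suc n ≡⟨ ∑-last (suc n) (λ k → cb k * ¼ ^ k) ⟨
  ∑< (suc (suc n)) (λ k → cb k * ¼ ^ k)                ∎
  where
  lem₁ : ∀ x y z → x * (y * (¼ * z)) ≡ (x * y) * (¼ * z)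
  lem₁ = solve-∀ ring
  lem₂ : ∀ n x y z → (ι 4 * (n * x) + y) * (¼ * z) ≡ n * (x * z) + y * (¼ * z)
  lem₂ = solve-∀ ring

-- With t = m - 4 and S the sum of the first n + 1 terms, mⁿ S / (n + 1) = ∑ᵢ coeff n i tⁱ; see ∑-expansion.
coeff : ℕ → ℕ → ℚ
coeff n i = c n * binom n i * β i i

coeff-zero : ∀ n → coeff n 0 ≡ c n
coeff-zero n = trans (cong (λ x → c n * x * 1ℚ) (binom-zero n)) (lem (c n))
  where
  lem : ∀ x → x * 1ℚ * 1ℚ ≡ x
  lem = solve-∀ ring

coeff-last : ∀ n → coeff n (suc n) ≡ 0ℚ
coeff-last n = trans (cong (λ x → c n * ι x * β (suc n) (suc n)) (k>n⇒nCk≡0 (ℕ.n<1+n n))) (lem (c n) (β (suc n) (suc n)))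
  where
  lem : ∀ x y → x * 0ℚ * y ≡ 0ℚ
  lem = solve-∀ ring

-- The comparison of the coefficients of tⁱ⁺¹ when the expansion for n is multiplied by m = 4 + t:
-- one contribution comes from t, the other from 4.
coeff-suc : ∀ n i → ι (suc (suc n)) * coeff (suc n) (suc i) ≡ ι (suc n) * (coeff n i + ι 4 * coeff n (suc i))
-- The factors 2i + 3 and i + 1 clear the denominators in `β-diag` and in the absorption identities,
-- so that both sides can be expressed through `binom n i` and `β i i`.
coeff-suc n i = *-cancelˡ-ι (suc (2 ℕ.* suc i)) (*-cancelˡ-ι (suc i) (begin
  I * (K * (ι (suc (suc n)) * (c (suc n) * binom (suc n) (suc i) * B′)))
    ≡⟨ lem₁ I K (ι (suc (suc n))) (c (suc n)) (binom (suc n) (suc i)) B′ ⟩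
  K * B′ * (ι (suc (suc n)) * c (suc n)) * (I * binom (suc n) (suc i))
    ≡⟨ cong₂ (λ x y → K * B′ * x * y) (c-rec n) (binom-absorb n i) ⟩
  K * B′ * (ι 2 * (1ℚ + ι 2 * N) * c n) * (N * binom n i)
    ≡⟨ lem₂ N (c n) (binom n i) (K * B′) ⟩
  (ι 2 * (K * B′)) * ((1ℚ + ι 2 * N) * c n) * (N * binom n i)
    ≡⟨ cong (λ x → x * ((1ℚ + ι 2 * N) * c n) * (N * binom n i)) KB ⟩
  (I * B) * ((1ℚ + ι 2 * N) * c n) * (N * binom n i)
    ≡⟨ cong (λ x → (I * B) * ((1ℚ + ι 2 * x) * c n) * (N * binom n i)) (ι-suc n) ⟩
  (I * B) * ((1ℚ + ι 2 * (1ℚ + ι n)) * c n) * (N * binom n i)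
    -- By 2n+3 = (2i+3) + 2(n-i) the product splits into the parts that belong to `coeff n i` and to
    -- `coeff n (suc i)`.
    ≡⟨ lem₃ (ι n) (ι i) I N (c n) (binom n i) B ⟩
  N * c n * ((1ℚ + ι 2 * (1ℚ + ι i)) * binom n i * (I * B) + ι 2 * (I * B) * ((ι n - ι i) * binom n i))
    ≡⟨ cong (λ x → N * c n * ((1ℚ + ι 2 * x) * binom n i * (I * B) + ι 2 * (I * B) * ((ι n - ι i) * binom n i))) (ι-suc i) ⟨
  N * c n * ((1ℚ + ι 2 * I) * binom n i * (I * B) + ι 2 * (I * B) * ((ι n - ι i) * binom n i))
    ≡⟨ cong₂ (λ x y → N * c n * (x * binom n i * (I * B) + ι 2 * (I * B) * y)) (sym (ι-1+2* (suc i))) (sym (binom-next n i)) ⟩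
  N * c n * (K * binom n i * (I * B) + ι 2 * (I * B) * (I * binom n (suc i)))
    ≡⟨ cong (λ x → N * c n * (K * binom n i * (I * B) + ι 2 * x * (I * binom n (suc i)))) KB ⟨
  N * c n * (K * binom n i * (I * B) + ι 2 * (ι 2 * (K * B′)) * (I * binom n (suc i)))
    ≡⟨ lem₄ I K N (c n) (binom n i) (binom n (suc i)) B B′ ⟩
  I * (K * (N * (c n * binom n i * B + ι 4 * (c n * binom n (suc i) * B′)))) ∎))
  where
  I = ι (suc i)
  K = ι (suc (2 ℕ.* suc i))
  N = ι (suc n)
  B = β i i
  B′ = β (suc i) (suc i)
  KB : ι 2 * (K * B′) ≡ I * B
  KB = trans (cong (λ x → ι 2 * (x * B′)) (trans (ι-1+2* (suc i)) (cong (λ x → 1ℚ + ι 2 * x) (ι-suc i)))) (trans (lem (ι i) B′) (β-diag i))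
    where
    lem : ∀ i b → ι 2 * ((1ℚ + ι 2 * (1ℚ + i)) * b) ≡ ι 2 * (ι 2 * i + ι 3) * b
    lem = solve-∀ ring
  lem₁ : ∀ j k n x y b → j * (k * (n * (x * y * b))) ≡ k * b * (n * x) * (j * y)
  lem₁ = solve-∀ ring
  lem₂ : ∀ n x y b → b * (ι 2 * (1ℚ + ι 2 * n) * x) * (n * y) ≡ (ι 2 * b) * ((1ℚ + ι 2 * n) * x) * (n * y)
  lem₂ = solve-∀ ring
  lem₃ : ∀ n i j m x y b → (j * b) * ((1ℚ + ι 2 * (1ℚ + n)) * x) * (m * y)
       ≡ m * x * ((1ℚ + ι 2 * (1ℚ + i)) * y * (j * b) + ι 2 * (j * b) * ((n - i) * y))
  lem₃ = solve-∀ ring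
  lem₄ : ∀ j k n x y y′ b b′ → n * x * (k * y * (j * b) + ι 2 * (ι 2 * (k * b′)) * (j * y′))
       ≡ j * (k * (n * (x * y * b + ι 4 * (x * y′ * b′))))
  lem₄ = solve-∀ ring

-- The summands enter multiplied by powers of M, so that the identity is polynomial. In the step the
-- new central binomial coefficient affects only the constant term, where `c-step` absorbs it;
-- `coeff-suc` matches the other powers of t.
∑-expansion : ∀ M t → M ≡ ι 4 + t → (summand : ℕ → ℚ) → (∀ k → M ^ k * summand k ≡ cb k) →
              ∀ n → M ^ n * ∑< (suc n) summand ≡ ι (suc n) * ∑< (suc n) (λ i → t ^ i * coeff n i)
∑-expansion M t M≡ summand eq zero = begin
  1ℚ * (summand 0 + 0ℚ)  ≡⟨ lem (summand 0) ⟩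
  1ℚ * summand 0         ≡⟨ eq 0 ⟩
  1ℚ                  ∎
  where
  lem : ∀ x → 1ℚ * (x + 0ℚ) ≡ 1ℚ * x
  lem = solve-∀ ring
∑-expansion M t M≡ summand eq (suc n) = begin
  M * M ^ n * ∑< (suc (suc n)) summand
    ≡⟨ cong (M * M ^ n *_) (∑-last (suc n) summand) ⟩
  M * M ^ n * (∑< (suc n) summand + summand (suc n))
    ≡⟨ lem₁ M (M ^ n) (∑< (suc n) summand) (summand (suc n)) ⟩
  M * (M ^ n * ∑< (suc n) summand) + M * M ^ n * summand (suc n)
    ≡⟨ cong₂ (λ x y → M * x + y) (∑-expansion M t M≡ summand eq n) (eq (suc n)) ⟩
  M * (N * X) + cb (suc n)
    ≡⟨ cong₂ (λ x y → x * (N * y) + cb (suc n)) M≡ X≡ ⟩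
  (ι 4 + t) * (N * (c n + t * Y)) + cb (suc n)
    ≡⟨ lem₂ t N (c n) Y (cb (suc n)) ⟩
  ι 4 * (N * c n) + cb (suc n) + t * (N * ((c n + t * Y) + ι 4 * Y))
    ≡⟨ cong₂ (λ x y → x + t * (N * (y + ι 4 * Y))) (c-step n) X≡ ⟨
  ι (suc (suc n)) * c (suc n) + t * (N * (X + ι 4 * Y))
    ≡⟨ lem₃ t N X Y (ι (suc (suc n)) * c (suc n)) ⟩
  ι (suc (suc n)) * c (suc n) + (t * N * X + t * N * ι 4 * Y)
    ≡⟨ cong (_+_ (ι (suc (suc n)) * c (suc n))) tail ⟨
  ι (suc (suc n)) * c (suc n) + (ι (suc (suc n)) * Z + 0ℚ * Z)
    ≡⟨ lem₄ (ι (suc (suc n))) (c (suc n)) Z ⟩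
  ι (suc (suc n)) * (1ℚ * c (suc n) + Z)
    ≡⟨ cong (λ x → ι (suc (suc n)) * (1ℚ * x + Z)) (coeff-zero (suc n)) ⟨
  ι (suc (suc n)) * (1ℚ * coeff (suc n) 0 + Z) ∎
  where
  N = ι (suc n)
  x y z : ℕ → ℚ
  x i = t ^ i * coeff n i
  y i = t ^ i * coeff n (suc i)
  z i = t ^ suc i * coeff (suc n) (suc i)
  X = ∑< (suc n) x
  Y = ∑< (suc n) y
  Z = ∑< (suc n) z
  -- A vanishing term i = n + 1 is appended, so that n + 1 terms remain after the constant one is
  -- split off, as many as in Z.
  X≡ : X ≡ c n + t * Y
  X≡ = begin
    X                                                ≡⟨ ℚ.+-identityʳ X ⟨
    X + 0ℚ                                           ≡⟨ cong (_+_ X) (trans (cong (t ^ suc n *_) (coeff-last n)) (ℚ.*-zeroʳ (t ^ suc n))) ⟨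
    X + t ^ suc n * coeff n (suc n)                  ≡⟨ ∑-last (suc n) (λ i → t ^ i * coeff n i) ⟨
    1ℚ * coeff n 0 + ∑< (suc n) (λ i → t ^ suc i * coeff n (suc i))
      ≡⟨ cong₂ _+_ (trans (ℚ.*-identityˡ (coeff n 0)) (coeff-zero n))
           (∑-linear (suc n) y y t 0ℚ (λ i → lem t (t ^ i) (coeff n (suc i)))) ⟩
    c n + (t * Y + 0ℚ * Y)                           ≡⟨ lem′ (c n) t Y ⟩
    c n + t * Y                                      ∎
    where
    lem : ∀ t x y → t * x * y ≡ t * (x * y) + 0ℚ * (x * y)
    lem = solve-∀ ring
    lem′ : ∀ x t y → x + (t * y + 0ℚ * y) ≡ x + t * y
    lem′ = solve-∀ ring
  -- The summand `0ℚ * Z` only matches the two-term shape of `∑-linear`, which is used here in both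
  -- directions.
  tail : ι (suc (suc n)) * Z + 0ℚ * Z ≡ t * N * X + t * N * ι 4 * Y
  tail = trans (sym (∑-linear (suc n) z z (ι (suc (suc n))) 0ℚ (λ i → sym (lem₀ (ι (suc (suc n)) * (t ^ suc i * coeff (suc n) (suc i))) (t ^ suc i * coeff (suc n) (suc i))))))
    (∑-linear (suc n) x y (t * N) (t * N * ι 4) (λ i → trans (lem (ι (suc (suc n))) t (t ^ i) (coeff (suc n) (suc i)))
       (trans (cong (t * t ^ i *_) (coeff-suc n i)) (lem′ t (t ^ i) N (coeff n i) (coeff n (suc i))))))
    where
    lem₀ : ∀ x y → x + 0ℚ * y ≡ x
    lem₀ = solve-∀ ring
    lem : ∀ n t x y → n * (t * x * y) ≡ t * x * (n * y)
    lem = solve-∀ ring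
    lem′ : ∀ t x n y z → t * x * (n * (y + ι 4 * z)) ≡ t * n * (x * y) + t * n * ι 4 * (x * z)
    lem′ = solve-∀ ring
  lem₁ : ∀ m x y z → m * x * (y + z) ≡ m * (x * y) + m * x * z
  lem₁ = solve-∀ ring
  lem₂ : ∀ t n x y z → (ι 4 + t) * (n * (x + t * y)) + z ≡ ι 4 * (n * x) + z + t * (n * ((x + t * y) + ι 4 * y))
  lem₂ = solve-∀ ring
  lem₃ : ∀ t n x y z → z + t * (n * (x + ι 4 * y)) ≡ z + (t * n * x + t * n * ι 4 * y)
  lem₃ = solve-∀ ring
  lem₄ : ∀ n x z → n * x + (n * z + 0ℚ * z) ≡ n * (1ℚ * x + z)
  lem₄ = solve-∀ ring

1^n≡1 : ∀ n → 1ℚ ^ n ≡ 1ℚ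
1^n≡1 zero    = refl
1^n≡1 (suc n) = trans (ℚ.*-identityˡ (1ℚ ^ n)) (1^n≡1 n)

^-inverse : ∀ {x y} → x * y ≡ 1ℚ → ∀ n → x ^ n * y ^ n ≡ 1ℚ
^-inverse {x} {y} eq n = trans (sym (^-distrib-* x y n)) (trans (cong (_^ n) eq) (1^n≡1 n))

-- The local ring at p, as a subring of ℚ

-- The denominator need not be the reduced one, so sums and products just multiply denominators. It
-- cannot be 0, because p divides 0.
record Integral (p : ℕ) (q : ℚ) : Set where
  constructor integral
  field
    num   : ℤ
    den   : ℕ
    p∤den : ¬ (p ∣ den)
    eq    : q * ι den ≡ fromℤ num

-- The fractional ideal generated by c. For c = 0 membership means x = 0.
record _∈_·ℤ₍_₎ (x c : ℚ) (p : ℕ) : Set where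
  constructor multiple
  field
    {quot} : ℚ
    int    : Integral p quot
    eq     : x ≡ c * quot

infix 4 _∈_·ℤ₍_₎

module LocalRing {p : ℕ} (pp : Prime p) where

  fromℤ-integral : ∀ i → Integral p (fromℤ i)
  fromℤ-integral i = integral i 1 (λ p∣1 → ¬prime[1] (subst Prime (∣1⇒≡1 p∣1) pp)) (ℚ.*-identityʳ (fromℤ i))

  ι-integral : ∀ n → Integral p (ι n)
  ι-integral n = fromℤ-integral (+ n)

  private
    ∤-* : ∀ {a b} → ¬ (p ∣ a) → ¬ (p ∣ b) → ¬ (p ∣ a ℕ.* b)
    ∤-* {a} {b} p∤a p∤b p∣ab = [ p∤a , p∤b ]′ (euclidsLemma a b pp p∣ab)

  +-integral : ∀ {x y} → Integral p x → Integral p y → Integral p (x + y)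
  +-integral {x} {y} (integral a b p∤b eq) (integral a′ b′ p∤b′ eq′) =
    integral (a ℤ.* + b′ ℤ.+ a′ ℤ.* + b) (b ℕ.* b′) (∤-* p∤b p∤b′) (begin
      (x + y) * ι (b ℕ.* b′)                      ≡⟨ cong ((x + y) *_) (ι-* b b′) ⟩
      (x + y) * (ι b * ι b′)                      ≡⟨ lem x y (ι b) (ι b′) ⟩
      (x * ι b) * ι b′ + (y * ι b′) * ι b         ≡⟨ cong₂ (λ u v → u * ι b′ + v * ι b) eq eq′ ⟩
      fromℤ a * ι b′ + fromℤ a′ * ι b             ≡⟨ cong₂ _+_ (fromℤ-homo-* a (+ b′)) (fromℤ-homo-* a′ (+ b)) ⟨
      fromℤ (a ℤ.* + b′) + fromℤ (a′ ℤ.* + b)     ≡⟨ fromℤ-homo-+ (a ℤ.* + b′) (a′ ℤ.* + b) ⟨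
      fromℤ (a ℤ.* + b′ ℤ.+ a′ ℤ.* + b)           ∎)
    where
    lem : ∀ x y b c → (x + y) * (b * c) ≡ (x * b) * c + (y * c) * b
    lem = solve-∀ ring

  *-integral : ∀ {x y} → Integral p x → Integral p y → Integral p (x * y)
  *-integral {x} {y} (integral a b p∤b eq) (integral a′ b′ p∤b′ eq′) =
    integral (a ℤ.* a′) (b ℕ.* b′) (∤-* p∤b p∤b′) (begin
      (x * y) * ι (b ℕ.* b′)       ≡⟨ cong ((x * y) *_) (ι-* b b′) ⟩
      (x * y) * (ι b * ι b′)       ≡⟨ lem x y (ι b) (ι b′) ⟩
      (x * ι b) * (y * ι b′)       ≡⟨ cong₂ _*_ eq eq′ ⟩
      fromℤ a * fromℤ a′           ≡⟨ fromℤ-homo-* a a′ ⟨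
      fromℤ (a ℤ.* a′)             ∎)
    where
    lem : ∀ x y b c → (x * y) * (b * c) ≡ (x * b) * (y * c)
    lem = solve-∀ ring

  -‿integral : ∀ {x} → Integral p x → Integral p (- x)
  -‿integral {x} ix = subst (Integral p) (lem x) (*-integral (fromℤ-integral -1ℤ) ix)
    where
    lem : ∀ x → -1ℚ * x ≡ - x
    lem = solve-∀ ring

  ^-integral : ∀ {x} n → Integral p x → Integral p (x ^ n)
  ^-integral zero    ix = ι-integral 1
  ^-integral (suc n) ix = *-integral ix (^-integral n ix)

  ∤⇒inverse-integral : ∀ {x} n → ¬ (p ∣ n) → x * ι n ≡ 1ℚ → Integral p x
  ∤⇒inverse-integral n p∤n eq = integral (+ 1) n p∤n eq

  ι⁻¹-integral : ∀ n .{{_ : NonZero n}} → ¬ (p ∣ n) → Integral p (ι⁻¹ n)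
  ι⁻¹-integral n p∤n = integral (+ 1) n p∤n (*-inverse-ι n)

  module _ {c : ℚ} where

    generates : ∀ {r} → Integral p r → c * r ∈ c ·ℤ₍ p ₎
    generates ir = multiple ir refl

    ∈-cong : ∀ {x y} → x ≡ y → x ∈ c ·ℤ₍ p ₎ → y ∈ c ·ℤ₍ p ₎
    ∈-cong = subst (_∈ c ·ℤ₍ p ₎)

    ∈-refl : c ∈ c ·ℤ₍ p ₎
    ∈-refl = multiple (ι-integral 1) (sym (ℚ.*-identityʳ c))

    ∈-zero : 0ℚ ∈ c ·ℤ₍ p ₎
    ∈-zero = multiple (ι-integral 0) (sym (ℚ.*-zeroʳ c))

    ∈-+ : ∀ {x y} → x ∈ c ·ℤ₍ p ₎ → y ∈ c ·ℤ₍ p ₎ → x + y ∈ c ·ℤ₍ p ₎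
    ∈-+ (multiple {r} ir refl) (multiple {s} is refl) = multiple (+-integral ir is) (sym (ℚ.*-distribˡ-+ c r s))

    ∈-* : ∀ {x} r → Integral p r → x ∈ c ·ℤ₍ p ₎ → r * x ∈ c ·ℤ₍ p ₎
    ∈-* r ir (multiple {s} is refl) = multiple (*-integral ir is) (lem r c s)
      where
      lem : ∀ r c s → r * (c * s) ≡ c * (r * s)
      lem = solve-∀ ring

    ∈-neg : ∀ {x} → x ∈ c ·ℤ₍ p ₎ → - x ∈ c ·ℤ₍ p ₎
    ∈-neg {x} x∈ = ∈-cong (lem x) (∈-* -1ℚ (fromℤ-integral -1ℤ) x∈)
      where
      lem : ∀ x → -1ℚ * x ≡ - x
      lem = solve-∀ ring

    ∈-- : ∀ {x y} → x ∈ c ·ℤ₍ p ₎ → y ∈ c ·ℤ₍ p ₎ → x - y ∈ c ·ℤ₍ p ₎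
    ∈-- x∈ y∈ = ∈-+ x∈ (∈-neg y∈)

    ∈-trans : ∀ {x d} → x ∈ c ·ℤ₍ p ₎ → c ∈ d ·ℤ₍ p ₎ → x ∈ d ·ℤ₍ p ₎
    ∈-trans {d = d} (multiple {r} ir refl) (multiple {s} is refl) = multiple (*-integral is ir) (ℚ.*-assoc d s r)

    ∈⇒integral : ∀ {x} → Integral p c → x ∈ c ·ℤ₍ p ₎ → Integral p x
    ∈⇒integral ic (multiple ir refl) = *-integral ic ir

    ∈-cancel : ∀ {x} u v → Integral p u → u * v ≡ 1ℚ → v * x ∈ c ·ℤ₍ p ₎ → x ∈ c ·ℤ₍ p ₎
    ∈-cancel {x} u v iu uv vx∈ = ∈-cong (trans (sym (ℚ.*-assoc u v x)) (trans (cong (_* x) uv) (ℚ.*-identityˡ x))) (∈-* u iu vx∈)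

    ≈-refl : ∀ x → x - x ∈ c ·ℤ₍ p ₎
    ≈-refl x = ∈-cong (sym (ℚ.+-inverseʳ x)) ∈-zero

    ≈-trans : ∀ x y z → x - y ∈ c ·ℤ₍ p ₎ → y - z ∈ c ·ℤ₍ p ₎ → x - z ∈ c ·ℤ₍ p ₎
    ≈-trans x y z xy yz = ∈-cong (lem x y z) (∈-+ xy yz)
      where
      lem : ∀ x y z → (x - y) + (y - z) ≡ x - z
      lem = solve-∀ ring

    ≈-* : ∀ x y u v → Integral p x → Integral p v → x - y ∈ c ·ℤ₍ p ₎ → u - v ∈ c ·ℤ₍ p ₎ → x * u - y * v ∈ c ·ℤ₍ p ₎
    ≈-* x y u v ix iv xy uv = ∈-cong (lem x y u v) (∈-+ (∈-* x ix uv) (∈-* v iv xy))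
      where
      lem : ∀ x y u v → x * (u - v) + v * (x - y) ≡ x * u - y * v
      lem = solve-∀ ring

    ≈-^ : ∀ {x y} n → Integral p x → Integral p y → x - y ∈ c ·ℤ₍ p ₎ → x ^ n - y ^ n ∈ c ·ℤ₍ p ₎
    ≈-^ zero    ix iy xy = ∈-zero
    ≈-^ {x} {y} (suc n) ix iy xy = ≈-* x y (x ^ n) (y ^ n) ix (^-integral n iy) xy (≈-^ n ix iy xy)

    ∑-∈ : ∀ n f → (∀ k → k ℕ.< n → f k ∈ c ·ℤ₍ p ₎) → ∑< n f ∈ c ·ℤ₍ p ₎
    ∑-∈ zero    f f∈ = ∈-zero
    ∑-∈ (suc n) f f∈ = ∈-+ (f∈ 0 ℕ.z<s) (∑-∈ n (f ∘ suc) (λ k k<n → f∈ (suc k) (ℕ.s<s k<n)))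

    D-∈ : ∀ n f → (∀ k → f k ∈ c ·ℤ₍ p ₎) → ∀ k → D n f k ∈ c ·ℤ₍ p ₎
    D-∈ zero    f f∈ k = f∈ k
    D-∈ (suc n) f f∈ k = ∈-- (D-∈ n f f∈ k) (D-∈ n f f∈ (suc k))

  ∈-scale : ∀ {x c} d → x ∈ c ·ℤ₍ p ₎ → d * x ∈ d * c ·ℤ₍ p ₎
  ∈-scale {_} {c} d (multiple {r} ir refl) = multiple ir (sym (ℚ.*-assoc d c r))

  D-integral : ∀ n f → (∀ k → Integral p (f k)) → ∀ k → Integral p (D n f k)
  D-integral n f if k = ∈⇒integral (ι-integral 1) (D-∈ n f (λ j → multiple {c = 1ℚ} (if j) (sym (ℚ.*-identityˡ (f j)))) k)

  c-integral : ∀ n → Integral p (c n)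
  c-integral n = ι-integral (suc (2 ℕ.* n) C n)

  binom-integral : ∀ n k → Integral p (binom n k)
  binom-integral n k = ι-integral (n C k)

  <p⇒∤ : ∀ n .{{_ : NonZero n}} → n ℕ.< p → ¬ (p ∣ n)
  <p⇒∤ n n<p p∣n = ℕ.<⇒≱ n<p (∣⇒≤ p∣n)

  -- A number below pᵉ⁺¹ contains p at most e times; each factor p found in n is paid for with one
  -- of the e factors. The inverse is a variable x so that the recursive call can pass to p x.
  p^e*inverse-integral : ∀ e n .{{_ : NonZero n}} x → n ℕ.< p ℕ.^ suc e → ι n * x ≡ 1ℚ → Integral p (ι p ^ e * x)
  p^e*inverse-integral e n x n< eq with p ∣? n
  ... | no p∤n = *-integral (^-integral e (ι-integral p)) (∤⇒inverse-integral n p∤n (trans (ℚ.*-comm x (ι n)) eq))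
  p^e*inverse-integral zero n x n< eq | yes p∣n = ⊥-elim (<p⇒∤ n (subst (n ℕ.<_) (ℕ.*-identityʳ p) n<) p∣n)
  p^e*inverse-integral (suc e) n x n< eq | yes (divides (suc k-1) refl) =
    subst (Integral p) (lem (ι p) (ι p ^ e) x)
      (p^e*inverse-integral e k (ι p * x) (ℕ.*-cancelʳ-< p k (p ℕ.^ suc e) (subst (k ℕ.* p ℕ.<_) (ℕ.*-comm p (p ℕ.^ suc e)) n<))
        (trans (sym (ℚ.*-assoc (ι k) (ι p) x)) (trans (cong (_* x) (sym (ι-* k p))) eq)))
    where
    k = suc k-1
    lem : ∀ p q x → q * (p * x) ≡ p * q * x
    lem = solve-∀ ring

  -- `β-suc` lowers j without raising the sum of the indices above i + j, so the bound persists down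
  -- to `β i 0`, which is 1/(i+1).
  p^e*β-integral : ∀ e i j → suc (i ℕ.+ j) ℕ.< p ℕ.^ suc e → Integral p (ι p ^ e * β i j)
  p^e*β-integral e i zero i< =
    p^e*inverse-integral e (suc i) (β i 0) (subst (λ k → suc k ℕ.< p ℕ.^ suc e) (ℕ.+-identityʳ i) i<) (β-zeroʳ i)
  p^e*β-integral e i (suc j) i< =
    subst (Integral p) (trans (lem (ι p ^ e) (β i j) (β (suc i) j)) (cong (ι p ^ e *_) (sym (β-suc i j))))
      (+-integral (p^e*β-integral e i j (ℕ.<-trans (ℕ.n<1+n (suc (i ℕ.+ j))) i<′))
        (-‿integral (p^e*β-integral e (suc i) j i<′)))
    where
    i<′ : suc (suc (i ℕ.+ j)) ℕ.< p ℕ.^ suc e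
    i<′ = subst (λ k → suc k ℕ.< p ℕ.^ suc e) (ℕ.+-suc i j) i<
    lem : ∀ q x y → q * x + - (q * y) ≡ q * (x - y)
    lem = solve-∀ ring

  -- Of the e + 1 factors t, e supply the power of p that makes the Beta value integral; the last
  -- one is kept as the generator.
  t^i*β-∈ : ∀ {t} e → t ∈ ι p ·ℤ₍ p ₎ → suc (suc e ℕ.+ suc e) ℕ.< p ℕ.^ suc e → t ^ suc e * β (suc e) (suc e) ∈ t ·ℤ₍ p ₎
  t^i*β-∈ {t} e (multiple {s} is t≡) lt =
    ∈-cong eq (generates (*-integral (^-integral e is) (p^e*β-integral e (suc e) (suc e) lt)))
    where
    B = β (suc e) (suc e)
    lem : ∀ t x y z → t * (x * (y * z)) ≡ t * (y * x) * z
    lem = solve-∀ ring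
    eq : t * (s ^ e * (ι p ^ e * B)) ≡ t ^ suc e * B
    eq = begin
      t * (s ^ e * (ι p ^ e * B))  ≡⟨ lem t (s ^ e) (ι p ^ e) B ⟩
      t * (ι p ^ e * s ^ e) * B    ≡⟨ cong (λ x → t * x * B) (^-distrib-* (ι p) s e) ⟨
      t * (ι p * s) ^ e * B        ≡⟨ cong (λ x → t * x ^ e * B) t≡ ⟨
      t * t ^ e * B                ∎

-- Lucas' congruence and Fermat's little theorem for 2

module Frobenius {p′ : ℕ} (pp : Prime (suc p′)) where

  open LocalRing pp

  private
    p = suc p′

    infix 4 _≈_
    _≈_ : ℚ → ℚ → Set
    x ≈ y = x - y ∈ ι p ·ℤ₍ p ₎

  -- In (k+1) C(p,k+1) = p C(p-1,k) the factor k + 1 < p is a unit.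
  binom-p-∈ : ∀ k → suc k ℕ.< p → binom p (suc k) ∈ ι p ·ℤ₍ p ₎
  binom-p-∈ k k<p = ∈-cancel (ι⁻¹ (suc k)) (ι (suc k)) (ι⁻¹-integral (suc k) (<p⇒∤ (suc k) k<p)) (*-inverse-ι (suc k))
    (∈-cong (sym (binom-absorb p′ k)) (generates (binom-integral p′ k)))

  -- The coefficients of (1 + x)^(M + p) ≡ (1 + x)^M (1 + x^p), first below degree p and then from p on.

  binom-+p-low : ∀ M k → k ℕ.< p → binom (M ℕ.+ p) k ≈ binom M k
  binom-+p-low M zero k<p = ∈-cong (sym (trans (cong₂ _-_ (binom-zero (M ℕ.+ p)) (binom-zero M)) refl)) ∈-zero
  binom-+p-low zero (suc k) k<p = ∈-cong (sym (ℚ.+-identityʳ (binom p (suc k)))) (binom-p-∈ k k<p)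
  binom-+p-low (suc M) (suc k) k<p = ∈-cong (begin
    (a - b) + (a′ - b′)  ≡⟨ lem a b a′ b′ ⟩
    (a + a′) - (b + b′)  ≡⟨ cong₂ _-_ (binom-pascal (M ℕ.+ p) k) (binom-pascal M k) ⟨
    binom (suc M ℕ.+ p) (suc k) - binom (suc M) (suc k) ∎)
    (∈-+ (binom-+p-low M k (ℕ.<-trans (ℕ.n<1+n k) k<p)) (binom-+p-low M (suc k) k<p))
    where
    a = binom (M ℕ.+ p) k
    a′ = binom (M ℕ.+ p) (suc k)
    b = binom M k
    b′ = binom M (suc k)
    lem : ∀ a b a′ b′ → (a - b) + (a′ - b′) ≡ (a + a′) - (b + b′)
    lem = solve-∀ ring

  binom-+p : ∀ M k → binom (M ℕ.+ p) (k ℕ.+ p) ≈ binom M (k ℕ.+ p) + binom M k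
  binom-+p zero zero = ∈-cong (sym (cong (λ x → ι x - 1ℚ) (nCn≡1 p))) ∈-zero
  binom-+p zero (suc k) = ∈-cong (sym (cong (λ x → ι x - 0ℚ) (k>n⇒nCk≡0 (ℕ.s≤s (ℕ.m≤n+m p k))))) ∈-zero
  -- Pascal's rule at degree p reaches down to degree p - 1, which belongs to the low range; the
  -- constant term of (1 + x)^M is 1 for every M.
  binom-+p (suc M) zero = ∈-cong (begin
    (a - b) + (a′ - (b′ + binom M 0))      ≡⟨ cong (λ x → (a - b) + (a′ - (b′ + x))) (binom-zero M) ⟩
    (a - b) + (a′ - (b′ + 1ℚ))             ≡⟨ lem a b a′ b′ ⟩
    (a + a′) - ((b + b′) + 1ℚ)             ≡⟨ cong₂ (λ x y → x - (y + 1ℚ)) (binom-pascal (M ℕ.+ p) p′) (binom-pascal M p′) ⟨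
    binom (suc M ℕ.+ p) p - (binom (suc M) p + 1ℚ) ≡⟨ cong (λ x → binom (suc M ℕ.+ p) p - (binom (suc M) p + x)) (binom-zero (suc M)) ⟨
    binom (suc M ℕ.+ p) p - (binom (suc M) p + binom (suc M) 0) ∎)
    (∈-+ (binom-+p-low M p′ (ℕ.n<1+n p′)) (binom-+p M zero))
    where
    a = binom (M ℕ.+ p) p′
    a′ = binom (M ℕ.+ p) p
    b = binom M p′
    b′ = binom M p
    lem : ∀ a b a′ b′ → (a - b) + (a′ - (b′ + 1ℚ)) ≡ (a + a′) - ((b + b′) + 1ℚ)
    lem = solve-∀ ring
  binom-+p (suc M) (suc k) = ∈-cong (begin
    (a - (b + d)) + (a′ - (b′ + d′))             ≡⟨ lem a b d a′ b′ d′ ⟩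
    (a + a′) - ((b + b′) + (d + d′))             ≡⟨ cong₂ _-_ (binom-pascal (M ℕ.+ p) (k ℕ.+ p)) (cong₂ _+_ (binom-pascal M (k ℕ.+ p)) (binom-pascal M k)) ⟨
    binom (suc M ℕ.+ p) (suc k ℕ.+ p) - (binom (suc M) (suc k ℕ.+ p) + binom (suc M) (suc k)) ∎)
    (∈-+ (binom-+p M k) (binom-+p M (suc k)))
    where
    a = binom (M ℕ.+ p) (k ℕ.+ p)
    a′ = binom (M ℕ.+ p) (suc k ℕ.+ p)
    b = binom M (k ℕ.+ p)
    b′ = binom M (suc k ℕ.+ p)
    d = binom M k
    d′ = binom M (suc k)
    lem : ∀ a b d a′ b′ d′ → (a - (b + d)) + (a′ - (b′ + d′)) ≡ (a + a′) - ((b + b′) + (d + d′))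
    lem = solve-∀ ring

  -- The coefficients in (1 + x)^(np) ≡ (1 + x^p)^n: raising the exponent by p acts on multiples of
  -- p as Pascal's rule acts on n and k.
  binom-frobenius : ∀ n k → binom (n ℕ.* p) (k ℕ.* p) ≈ binom n k
  binom-frobenius n zero = ∈-cong (sym (cong₂ _-_ (binom-zero (n ℕ.* p)) (binom-zero n))) ∈-zero
  binom-frobenius zero (suc k) = ∈-zero
  binom-frobenius (suc n) (suc k) =
    subst₂ (λ i j → binom i j ≈ binom (suc n) (suc k)) (ℕ.+-comm (n ℕ.* p) p) (ℕ.+-comm (k ℕ.* p) p)
      (∈-cong (trans (lem a b d e f) (cong (λ x → a - x) (sym (binom-pascal n k))))
        (∈-+ (binom-+p (n ℕ.* p) (k ℕ.* p))
          (∈-+ (subst (λ i → binom (n ℕ.* p) i ≈ binom n (suc k)) (ℕ.+-comm p (k ℕ.* p)) (binom-frobenius n (suc k)))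
            (binom-frobenius n k))))
    where
    a = binom (n ℕ.* p ℕ.+ p) (k ℕ.* p ℕ.+ p)
    b = binom (n ℕ.* p) (k ℕ.* p ℕ.+ p)
    d = binom (n ℕ.* p) (k ℕ.* p)
    e = binom n (suc k)
    f = binom n k
    lem : ∀ a b d e f → (a - (b + d)) + ((b - e) + (d - f)) ≡ a - (f + e)
    lem = solve-∀ ring

  -- C(2n,n) = 2 c (n - 1), and 2 is invertible.
  c-frobenius : ¬ (p ∣ 2) → ∀ a N s → suc N ≡ suc s ℕ.* p ℕ.^ a → c N ≈ c s
  c-frobenius p∤2 zero N s eq = subst (λ k → c N ≈ c k) (ℕ.suc-injective (trans eq (ℕ.*-identityʳ (suc s)))) (≈-refl (c N))
  c-frobenius p∤2 (suc a) N s eq = ≈-trans (c N) (c s′) (c s)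
    (c-frobenius p∤2 a N s′ (trans eq (sym (ℕ.*-assoc (suc s) p (p ℕ.^ a)))))
    (∈-cancel (ι⁻¹ 2) (ι 2) (ι⁻¹-integral 2 p∤2) refl
      (∈-cong (begin
        binom (2 ℕ.* suc s ℕ.* p) (suc s ℕ.* p) - cb (suc s)   ≡⟨ cong (λ k → binom k (suc s ℕ.* p) - cb (suc s)) (ℕ.*-assoc 2 (suc s) p) ⟩
        cb (suc s′) - cb (suc s)                              ≡⟨ cong₂ _-_ (cb-suc s′) (cb-suc s) ⟩
        ι 2 * c s′ - ι 2 * c s                                ≡⟨ lem (c s′) (c s) ⟩
        ι 2 * (c s′ - c s)                                    ∎)
        (binom-frobenius (2 ℕ.* suc s) (suc s))))
    where
    -- Chosen so that `suc s′` computes to `suc s ℕ.* p`.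
    s′ = p′ ℕ.+ s ℕ.* p
    lem : ∀ x y → ι 2 * x - ι 2 * y ≡ ι 2 * (x - y)
    lem = solve-∀ ring

  -- 2ᵖ is the p-th iterated difference of (-1)ᵏ.
  2^p≈2 : ι 2 ^ p ≈ ι 2
  2^p≈2 = ∈-cong (begin
    ∑< p′ (summand ∘ suc)                                        ≡⟨ lem (∑< p′ (summand ∘ suc)) ⟩
    1ℚ + (∑< p′ (summand ∘ suc) + 1ℚ) - ι 2                       ≡⟨ cong₂ (λ x y → x + (∑< p′ (summand ∘ suc) + y) - ι 2) summand-zero summand-p ⟨
    summand 0 + (∑< p′ (summand ∘ suc) + summand p) - ι 2               ≡⟨ cong (λ x → summand 0 + x - ι 2) (∑-last p′ (summand ∘ suc)) ⟨
    ∑< (suc p) summand - ι 2                                     ≡⟨ cong (_- ι 2) (∑-binom-D p (-1ℚ ^_)) ⟩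
    D p (-1ℚ ^_) 0 - ι 2                                      ≡⟨ cong (_- ι 2) (trans (D-sign p 0) (ℚ.*-identityʳ (ι 2 ^ p))) ⟩
    ι 2 ^ p - ι 2                                             ∎)
    (∑-∈ p′ (summand ∘ suc) (λ k k<p′ → ∈-cong (lem′ (binom p (suc k)) (-1ℚ ^ suc k))
      (∈-* (-1ℚ ^ suc k * -1ℚ ^ suc k) (*-integral (sign-integral (suc k)) (sign-integral (suc k))) (binom-p-∈ k (ℕ.s<s k<p′)))))
    where
    -- One sign belongs to the iterated difference and one to the sequence. They cancel, so the two
    -- end terms are 1 and all others are multiples of p.
    summand : ℕ → ℚ
    summand k = binom p k * -1ℚ ^ k * -1ℚ ^ k
    sign-integral : ∀ k → Integral p (-1ℚ ^ k)
    sign-integral k = ^-integral k (fromℤ-integral -1ℤ)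
    sign² : ∀ k → -1ℚ ^ k * -1ℚ ^ k ≡ 1ℚ
    sign² zero = refl
    sign² (suc k) = trans (lem₀ (-1ℚ ^ k)) (sign² k)
      where
      lem₀ : ∀ x → (-1ℚ * x) * (-1ℚ * x) ≡ x * x
      lem₀ = solve-∀ ring
    D-sign : ∀ n k → D n (-1ℚ ^_) k ≡ ι 2 ^ n * -1ℚ ^ k
    D-sign zero k = sym (ℚ.*-identityˡ (-1ℚ ^ k))
    D-sign (suc n) k = trans (cong₂ _-_ (D-sign n k) (D-sign n (suc k))) (lem₀ (ι 2 ^ n) (-1ℚ ^ k))
      where
      lem₀ : ∀ x y → x * y - x * (-1ℚ * y) ≡ ι 2 * x * y
      lem₀ = solve-∀ ring
    lem : ∀ x → x ≡ 1ℚ + (x + 1ℚ) - ι 2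
    lem = solve-∀ ring
    lem′ : ∀ x y → (y * y) * x ≡ x * y * y
    lem′ = solve-∀ ring
    summand-zero : summand 0 ≡ 1ℚ
    summand-zero = cong (λ x → x * 1ℚ * 1ℚ) (binom-zero p)
    summand-p : summand p ≡ 1ℚ
    summand-p = trans (cong (λ x → ι x * -1ℚ ^ p * -1ℚ ^ p) (nCn≡1 p)) (trans (lem₀ (-1ℚ ^ p)) (sign² p))
      where
      lem₀ : ∀ x → 1ℚ * x * x ≡ x * x
      lem₀ = solve-∀ ring

  4^p^a≈4 : ∀ a → ι 4 ^ (p ℕ.^ a) ≈ ι 4
  4^p^a≈4 zero = ∈-cong (sym (cong (_- ι 4) (ℚ.*-identityʳ (ι 4)))) ∈-zero
  4^p^a≈4 (suc a) = ≈-trans (ι 4 ^ (p ℕ.^ suc a)) (ι 4 ^ (p ℕ.^ a)) (ι 4)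
    (∈-cong (cong (_- ι 4 ^ (p ℕ.^ a)) (^-assocʳ (ι 4) p (p ℕ.^ a)))
      (≈-^ (p ℕ.^ a) (^-integral p (ι-integral 4)) (ι-integral 4)
        (∈-cong (cong (_- ι 4) 2^p*2^p) (≈-* (ι 2 ^ p) (ι 2) (ι 2 ^ p) (ι 2) (^-integral p (ι-integral 2)) (ι-integral 2) 2^p≈2 2^p≈2))))
    (4^p^a≈4 a)
    where
    2^p*2^p : ι 2 ^ p * ι 2 ^ p ≡ ι 4 ^ p
    2^p*2^p = sym (^-distrib-* (ι 2) (ι 2) p)

  -- Here 4 · 4ᴺ is 4 to the power pᵃ, hence congruent to 4, and 4 is a unit.
  ¼^-≈1 : ¬ (p ∣ 4) → ∀ a N → suc N ≡ p ℕ.^ a → ¼ ^ N ≈ 1ℚ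
  ¼^-≈1 p∤4 a N eq = ∈-cong (begin
    - (¼ * (¼ ^ N * (ι 4 * ι 4 ^ N - ι 4)))     ≡⟨ lem (¼ ^ N) (ι 4 ^ N) ⟩
    ¼ ^ N - ¼ ^ N * ι 4 ^ N                     ≡⟨ cong (_-_ (¼ ^ N)) (^-inverse refl N) ⟩
    ¼ ^ N - 1ℚ                                  ∎)
    (∈-neg (∈-* ¼ i¼ (∈-* (¼ ^ N) (^-integral N i¼) (subst (λ k → ι 4 ^ k ≈ ι 4) (sym eq) (4^p^a≈4 a)))))
    where
    i¼ : Integral p ¼
    i¼ = ι⁻¹-integral 4 p∤4
    lem : ∀ x y → - (¼ * (x * (ι 4 * y - ι 4))) ≡ x - x * y
    lem = solve-∀ ring

-- Ideals of the local ring and valuations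

p^k∣a*b⇒p^k∣a : ∀ {p} → Prime p → ∀ k {a b} → ¬ (p ∣ b) → p ℕ.^ k ∣ a ℕ.* b → p ℕ.^ k ∣ a
p^k∣a*b⇒p^k∣a {p} pp zero {a} p∤b d = 1∣ a
p^k∣a*b⇒p^k∣a {p} pp (suc k) {a} {b} p∤b d with euclidsLemma a b pp (∣-trans (m∣m*n (p ℕ.^ k)) d)
... | inj₂ p∣b = ⊥-elim (p∤b p∣b)
... | inj₁ (divides a′ refl) = subst (p ℕ.^ suc k ∣_) (ℕ.*-comm p a′) (*-monoʳ-∣ p
    (p^k∣a*b⇒p^k∣a pp k p∤b (*-cancelˡ-∣ p (subst (p ℕ.^ suc k ∣_) (trans (cong (ℕ._* b) (ℕ.*-comm a′ p)) (ℕ.*-assoc p a′ b)) d))))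
  where instance _ = prime⇒nonZero pp

module Valuation {p : ℕ} (pp : Prime p) where

  open LocalRing pp

  private instance
    _ = prime⇒nonTrivial pp
    _ = prime⇒nonZero pp

  private
    -- x/d is the reduced fraction on which `ν` is computed, pᵉa/b the one at hand. The equation
    -- makes p^(e + ν(d)) a divisor of x b, hence of x.
    bound : ∀ e x a b d .{{_ : NonZero x}} .{{_ : NonZero d}} → ¬ (p ∣ b) →
            x ℕ.* b ≡ p ℕ.^ e ℕ.* a ℕ.* d → + e ℤ.≤ + νℕ p x ℤ.- + νℕ p d
    bound e x a b d p∤b eq = subst (ℤ._≤ + νℕ p x ℤ.- + νℕ p d) (lem (+ e) (+ νℕ p d))
      (ℤ.+-monoˡ-≤ (ℤ.- + νℕ p d) (ℤ.+≤+ (νℕ-greatest p x (e ℕ.+ νℕ p d) (p^k∣a*b⇒p^k∣a pp (e ℕ.+ νℕ p d) p∤b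
        (subst (p ℕ.^ (e ℕ.+ νℕ p d) ∣_) (sym eq) (subst (_∣ p ℕ.^ e ℕ.* a ℕ.* d) (sym (ℕ.^-distribˡ-+-* p e (νℕ p d)))
          (*-pres-∣ {o = p ℕ.^ e} (m∣m*n a) (νℕ-divides p d))))))))
      where
      lem : ∀ i j → (i ℤ.+ j) ℤ.- j ≡ i
      lem = ℤ.solve-∀

    clear-denominators : ∀ {e q a b} → q * ι b ≡ ι (p ℕ.^ e) * fromℤ a →
                         ℤ.∣ ℚ.↥ q ∣ ℕ.* b ≡ p ℕ.^ e ℕ.* ℤ.∣ a ∣ ℕ.* ℚ.↧ₙ q
    clear-denominators {e} {q} {a} {b} eq = begin
      ℤ.∣ x ∣ ℕ.* b                       ≡⟨ ℤ.abs-* x (+ b) ⟨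
      ℤ.∣ x ℤ.* + b ∣                     ≡⟨ cong ℤ.∣_∣ (fromℤ-injective xb) ⟩
      ℤ.∣ + (p ℕ.^ e) ℤ.* a ℤ.* + d ∣     ≡⟨ ℤ.abs-* (+ (p ℕ.^ e) ℤ.* a) (+ d) ⟩
      ℤ.∣ + (p ℕ.^ e) ℤ.* a ∣ ℕ.* d       ≡⟨ cong (ℕ._* d) (ℤ.abs-* (+ (p ℕ.^ e)) a) ⟩
      p ℕ.^ e ℕ.* ℤ.∣ a ∣ ℕ.* d           ∎
      where
      x = ℚ.↥ q
      d = ℚ.↧ₙ q
      q*d : q * ι d ≡ fromℤ x
      q*d = trans (cong (_* ι d) (sym (ℚ.↥p/↧p≡p q))) (/-* x d)
      lem : ∀ q b d → (q * d) * b ≡ (q * b) * d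
      lem = solve-∀ ring
      xb : fromℤ (x ℤ.* + b) ≡ fromℤ (+ (p ℕ.^ e) ℤ.* a ℤ.* + d)
      xb = begin
        fromℤ (x ℤ.* + b)                        ≡⟨ fromℤ-homo-* x (+ b) ⟩
        fromℤ x * ι b                            ≡⟨ cong (_* ι b) q*d ⟨
        (q * ι d) * ι b                          ≡⟨ lem q (ι b) (ι d) ⟩
        (q * ι b) * ι d                          ≡⟨ cong (_* ι d) eq ⟩
        (ι (p ℕ.^ e) * fromℤ a) * ι d            ≡⟨ cong (_* ι d) (fromℤ-homo-* (+ (p ℕ.^ e)) a) ⟨
        fromℤ (+ (p ℕ.^ e) ℤ.* a) * ι d          ≡⟨ fromℤ-homo-* (+ (p ℕ.^ e) ℤ.* a) (+ d) ⟨
        fromℤ (+ (p ℕ.^ e) ℤ.* a ℤ.* + d)        ∎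

  ν-lower-bound : ∀ e q a b → ¬ (p ∣ b) → q * ι b ≡ ι (p ℕ.^ e) * fromℤ a → [ + e ] ≤⁺ ν p q
  ν-lower-bound e (mkℚ (+ zero) d-1 _) a b p∤b eq = [ + e ] Sup.≤⊤⁺
  ν-lower-bound e q@(mkℚ +[1+ n ] d-1 _) a b p∤b eq =
    Sup.[ bound e (suc n) ℤ.∣ a ∣ b (suc d-1) p∤b (clear-denominators {e} {q} {a} {b} eq) ]
  ν-lower-bound e q@(mkℚ -[1+ n ] d-1 _) a b p∤b eq =
    Sup.[ bound e (suc n) ℤ.∣ a ∣ b (suc d-1) p∤b (clear-denominators {e} {q} {a} {b} eq) ]

  ∈⇒≤ν : ∀ e i {q} → p ℕ.^ e ∣ ℤ.∣ i ∣ → q ∈ fromℤ i ·ℤ₍ p ₎ → [ + e ] ≤⁺ ν p q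
  ∈⇒≤ν e i {q} p^e∣i (multiple {r} (integral a b p∤b r*b) q≡) with ∣ᵤ⇒∣ {+ (p ℕ.^ e)} {i} p^e∣i
  ... | Signed.divides k i≡ = ν-lower-bound e q (k ℤ.* a) b p∤b (begin
    q * ι b                               ≡⟨ cong (_* ι b) q≡ ⟩
    fromℤ i * r * ι b                     ≡⟨ ℚ.*-assoc (fromℤ i) r (ι b) ⟩
    fromℤ i * (r * ι b)                   ≡⟨ cong₂ _*_ (trans (cong fromℤ i≡) (fromℤ-homo-* k (+ (p ℕ.^ e)))) r*b ⟩
    fromℤ k * ι (p ℕ.^ e) * fromℤ a       ≡⟨ lem (fromℤ k) (ι (p ℕ.^ e)) (fromℤ a) ⟩
    ι (p ℕ.^ e) * (fromℤ k * fromℤ a)     ≡⟨ cong (ι (p ℕ.^ e) *_) (fromℤ-homo-* k a) ⟨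
    ι (p ℕ.^ e) * fromℤ (k ℤ.* a)         ∎)
    where
    lem : ∀ x y z → x * y * z ≡ y * (x * z)
    lem = solve-∀ ring

  0ℚ-≤ν : ∀ {q} e → q ≡ 0ℚ → e ≤⁺ ν p q
  0ℚ-≤ν e refl = e Sup.≤⊤⁺

  ∈-zero⇒≡0 : ∀ {q} → q ∈ 0ℚ ·ℤ₍ p ₎ → q ≡ 0ℚ
  ∈-zero⇒≡0 (multiple {r} _ q≡) = trans q≡ (ℚ.*-zeroˡ r)

  -- For i = 0 the ideal is zero and both valuations are +∞; this is where the case m = 4 becomes an
  -- equality.
  ∈⇒νℤ≤ν : ∀ i {q} → q ∈ fromℤ i ·ℤ₍ p ₎ → νℤ p i ≤⁺ ν p q
  ∈⇒νℤ≤ν (+ zero)     q∈ = 0ℚ-≤ν ⊤⁺ (∈-zero⇒≡0 q∈)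
  ∈⇒νℤ≤ν i@(+[1+ n ]) q∈ = ∈⇒≤ν (νℕ p (suc n)) i (νℕ-divides p (suc n)) q∈
  ∈⇒νℤ≤ν i@(-[1+ n ]) q∈ = ∈⇒≤ν (νℕ p (suc n)) i (νℕ-divides p (suc n)) q∈

  -- Serves p = 3, where the alternating sum is controlled only modulo j = (m-4)/3.
  ∈⇒νℤ-1≤ν : ∀ i j {q} → i ≡ + p ℤ.* j → q ∈ fromℤ j ·ℤ₍ p ₎ → νℤ p i -⁺ + 1 ≤⁺ ν p q
  ∈⇒νℤ-1≤ν i j {q} i≡ q∈ = go i refl
    where
    pred-bound : ∀ e → p ℕ.^ e ∣ ℤ.∣ i ∣ → [ + e ℤ.- + 1 ] ≤⁺ ν p q
    -- The required bound is -1, and integrality already gives 0.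
    pred-bound zero    _ = Sup.≤⁺-trans ℤ.≤-trans Sup.[ ℤ.-≤+ ] (∈⇒≤ν 0 j (1∣ ℤ.∣ j ∣) q∈)
    pred-bound (suc e) d = ∈⇒≤ν e j (*-cancelˡ-∣ p (subst (p ℕ.^ suc e ∣_) (trans (cong ℤ.∣_∣ i≡) (ℤ.abs-* (+ p) j)) d)) q∈
    go : ∀ i′ → i ≡ i′ → νℤ p i′ -⁺ + 1 ≤⁺ ν p q
    go (+ zero) i≡0 = 0ℚ-≤ν ⊤⁺ (∈-zero⇒≡0 (subst (λ x → q ∈ fromℤ x ·ℤ₍ p ₎)
      (ℤ.*-cancelˡ-≡ (+ p) j (+ 0) (trans (sym i≡) (trans i≡0 (sym (ℤ.*-zeroʳ (+ p)))))) q∈))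
    go +[1+ n ] refl = pred-bound (νℕ p (suc n)) (νℕ-divides p (suc n))
    go -[1+ n ] refl = pred-bound (νℕ p (suc n)) (νℕ-divides p (suc n))

-- The sums of the theorem divided by n

/-unique : ∀ i d .{{_ : NonZero d}} {y} → y * ι d ≡ fromℤ i → i ℚ./ d ≡ y
/-unique i d {y} eq = *-cancelˡ-ι d (trans (ℚ.*-comm (ι d) (i ℚ./ d)) (trans (/-* i d) (trans (sym eq) (ℚ.*-comm y (ι d)))))

÷-unique : ∀ {x y z} .{{_ : ℚ.NonZero y}} → z * y ≡ x → x ℚ.÷ y ≡ z
÷-unique {x} {y} {z} eq = begin
  x * ℚ.1/ y       ≡⟨ cong (_* ℚ.1/ y) eq ⟨
  z * y * ℚ.1/ y   ≡⟨ ℚ.*-assoc z y (ℚ.1/ y) ⟩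
  z * (y * ℚ.1/ y) ≡⟨ cong (z *_) (ℚ.*-inverseʳ y) ⟩
  z * 1ℚ           ≡⟨ ℚ.*-identityʳ z ⟩
  z                ∎

cat : ℕ → ℚ
cat n = ι⁻¹ (suc n) * cb n

-- By 2(n+1) - (2n+1) = 1. It shows the Catalan number to be an integer even where p divides n + 1.
cat≡2cb-c : ∀ n → cat n ≡ ι 2 * cb n - c n
cat≡2cb-c n = *-cancelˡ-ι (suc n) (begin
  ι (suc n) * (ι⁻¹ (suc n) * cb n)                    ≡⟨ lem₁ (ι (suc n)) (ι⁻¹ (suc n)) (cb n) ⟩
  (ι⁻¹ (suc n) * ι (suc n)) * cb n                    ≡⟨ cong (_* cb n) (*-inverse-ι (suc n)) ⟩
  1ℚ * cb n                                           ≡⟨ lem₂ (ι n) (cb n) ⟩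
  ι 2 * (1ℚ + ι n) * cb n - (1ℚ + ι 2 * ι n) * cb n   ≡⟨ cong₂ (λ x y → ι 2 * x * cb n - y) (sym (ι-suc n)) (sym (c-cb n)) ⟩
  ι 2 * ι (suc n) * cb n - ι (suc n) * c n            ≡⟨ lem₃ (ι (suc n)) (cb n) (c n) ⟩
  ι (suc n) * (ι 2 * cb n - c n)                      ∎)
  where
  lem₁ : ∀ x y z → x * (y * z) ≡ (y * x) * z
  lem₁ = solve-∀ ring
  lem₂ : ∀ n x → 1ℚ * x ≡ ι 2 * (1ℚ + n) * x - (1ℚ + ι 2 * n) * x
  lem₂ = solve-∀ ring
  lem₃ : ∀ n x y → ι 2 * n * x - n * y ≡ n * (ι 2 * x - y)
  lem₃ = solve-∀ ring

module Sums {p : ℕ} (pp : Prime p) (p∤4 : ¬ (p ∣ 4)) {M t u : ℚ} (M≡4+t : M ≡ ι 4 + t)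
  (u*M≡1 : u * M ≡ 1ℚ) (u-integral : Integral p u)
  (summand : ℕ → ℚ) (M^k*summand : ∀ k → M ^ k * summand k ≡ cb k) where

  open LocalRing pp

  mean : ℕ → ℚ
  mean n = ι⁻¹ (suc n) * ∑< (suc n) summand

  ι*mean : ∀ n → ι (suc n) * mean n ≡ ∑< (suc n) summand
  ι*mean n = trans (lem (ι (suc n)) (ι⁻¹ (suc n)) (∑< (suc n) summand))
    (trans (cong (_* ∑< (suc n) summand) (*-inverse-ι (suc n))) (ℚ.*-identityˡ (∑< (suc n) summand)))
    where
    lem : ∀ x y z → x * (y * z) ≡ (y * x) * z
    lem = solve-∀ ring

  private
    expansion : ℕ → ℚ
    expansion n = ∑< n (λ i → t ^ suc i * coeff n (suc i))

  mean-expansion : ∀ n → mean n ≡ u ^ n * (c n + expansion n)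
  mean-expansion n = *-cancelˡ-ι (suc n) (begin
    ι (suc n) * mean n                 ≡⟨ ι*mean n ⟩
    Σ                                  ≡⟨ ℚ.*-identityˡ Σ ⟨
    1ℚ * Σ                             ≡⟨ cong (_* Σ) (^-inverse u*M≡1 n) ⟨
    u ^ n * M ^ n * Σ                  ≡⟨ ℚ.*-assoc (u ^ n) (M ^ n) Σ ⟩
    u ^ n * (M ^ n * Σ)                ≡⟨ cong (u ^ n *_) (∑-expansion M t M≡4+t summand M^k*summand n) ⟩
    u ^ n * (ι (suc n) * (1ℚ * coeff n 0 + expansion n))
      ≡⟨ cong (λ x → u ^ n * (ι (suc n) * (1ℚ * x + expansion n))) (coeff-zero n) ⟩
    u ^ n * (ι (suc n) * (1ℚ * c n + expansion n))
      ≡⟨ lem (u ^ n) (ι (suc n)) (c n) (expansion n) ⟩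
    ι (suc n) * (u ^ n * (c n + expansion n)) ∎)
    where
    Σ = ∑< (suc n) summand
    lem : ∀ u n x y → u * (n * (1ℚ * x + y)) ≡ n * (u * (x + y))
    lem = solve-∀ ring

  ¼-integral : Integral p ¼
  ¼-integral = ι⁻¹-integral 4 p∤4

  u≈¼ : u - ¼ ∈ t ·ℤ₍ p ₎
  u≈¼ = ∈-cong (begin
    - (u * ¼ * t)                   ≡⟨ lem u t ⟩
    u - ¼ * (u * (ι 4 + t))         ≡⟨ cong (λ x → u - ¼ * (u * x)) M≡4+t ⟨
    u - ¼ * (u * M)                 ≡⟨ cong (λ x → u - ¼ * x) u*M≡1 ⟩
    u - ¼                           ∎)
    (∈-neg (∈-* (u * ¼) (*-integral u-integral ¼-integral) ∈-refl))
    where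
    lem : ∀ u t → - (u * ¼ * t) ≡ u - ¼ * (u * (ι 4 + t))
    lem = solve-∀ ring

  u^≈¼^ : ∀ n → u ^ n - ¼ ^ n ∈ t ·ℤ₍ p ₎
  u^≈¼^ n = ≈-^ n u-integral ¼-integral u≈¼

  cat-integral : ∀ n → Integral p (cat n)
  cat-integral n = subst (Integral p) (sym (cat≡2cb-c n))
    (+-integral (*-integral (ι-integral 2) (binom-integral (2 ℕ.* n) n)) (-‿integral (c-integral n)))

  t^i*coeff-∈ : ∀ {d} n e → t ^ suc e * β (suc e) (suc e) ∈ d ·ℤ₍ p ₎ → t ^ suc e * coeff n (suc e) ∈ d ·ℤ₍ p ₎
  t^i*coeff-∈ n e β∈ = ∈-cong (lem (t ^ suc e) (c n) (binom n (suc e)) (β (suc e) (suc e)))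
    (∈-* (c n * binom n (suc e)) (*-integral (c-integral n) (binom-integral n (suc e))) β∈)
    where
    lem : ∀ t x y z → (x * y) * (t * z) ≡ t * (x * y * z)
    lem = solve-∀ ring

  -- The modulus d will be t for p ≠ 3, and t/p where p = 3 has to be included.
  module _ {d : ℚ} (t∈d : t ∈ d ·ℤ₍ p ₎) (t^i*β∈d : ∀ e → t ^ suc e * β (suc e) (suc e) ∈ d ·ℤ₍ p ₎) where

    mean≈c : ∀ n → mean n - c n * ¼ ^ n ∈ d ·ℤ₍ p ₎
    mean≈c n = ∈-cong (begin
      u ^ n * expansion n + c n * (u ^ n - ¼ ^ n)   ≡⟨ lem (u ^ n) (expansion n) (c n) (¼ ^ n) ⟩
      u ^ n * (c n + expansion n) - c n * ¼ ^ n     ≡⟨ cong (_- c n * ¼ ^ n) (mean-expansion n) ⟨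
      mean n - c n * ¼ ^ n                          ∎)
      (∈-+ (∈-* (u ^ n) (^-integral n u-integral)
             (∑-∈ n (λ i → t ^ suc i * coeff n (suc i)) (λ e _ → t^i*coeff-∈ n e (t^i*β∈d e))))
           (∈-* (c n) (c-integral n) (∈-trans (u^≈¼^ n) t∈d)))
      where
      lem : ∀ u y x q → u * y + x * (u - q) ≡ u * (x + y) - x * q
      lem = solve-∀ ring

    -- The mean differs from the p-integral number c(n)/4ⁿ by an element of an integral ideal. This
    -- is the divisibility of S by n.
    mean-integral : Integral p d → ∀ n → Integral p (mean n)
    mean-integral d-integral n = subst (Integral p) (lem (mean n) (c n * ¼ ^ n))
      (+-integral (∈⇒integral d-integral (mean≈c n)) (*-integral (c-integral n) (^-integral n ¼-integral)))
      where
      lem : ∀ x y → (x - y) + y ≡ x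
      lem = solve-∀ ring

    -- The values c(k)/4ᵏ are the means for m = 4, so `D-partial-sums` applies to them as well and
    -- divides the value in `D-cb` by n + 1, which turns C(2n,n) into the Catalan number.
    D-mean≈cat : ∀ n → D n mean 0 - cat n * ¼ ^ n ∈ d ·ℤ₍ p ₎
    D-mean≈cat n = ∈-cong (begin
      D n (λ k → mean k - c k * ¼ ^ k) 0         ≡⟨ D-homo-- n mean (λ k → c k * ¼ ^ k) 0 ⟩
      D n mean 0 - D n (λ k → c k * ¼ ^ k) 0     ≡⟨ cong (_-_ (D n mean 0)) (*-cancelˡ-ι (suc n) main) ⟩
      D n mean 0 - cat n * ¼ ^ n                 ∎)
      (D-∈ n _ mean≈c 0)
      where
      lem : ∀ x y z q → (y * x) * (z * q) ≡ x * (y * z * q)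
      lem = solve-∀ ring
      main : ι (suc n) * D n (λ k → c k * ¼ ^ k) 0 ≡ ι (suc n) * (cat n * ¼ ^ n)
      main = begin
        ι (suc n) * D n (λ k → c k * ¼ ^ k) 0            ≡⟨ D-partial-sums n (λ k → cb k * ¼ ^ k) (λ k → c k * ¼ ^ k) ∑-cb-¼ ⟨
        D n (λ k → cb k * ¼ ^ k) 0                       ≡⟨ D-cb n ⟩
        cb n * ¼ ^ n                                     ≡⟨ ℚ.*-identityˡ (cb n * ¼ ^ n) ⟨
        1ℚ * (cb n * ¼ ^ n)                              ≡⟨ cong (_* (cb n * ¼ ^ n)) (*-inverse-ι (suc n)) ⟨
        (ι⁻¹ (suc n) * ι (suc n)) * (cb n * ¼ ^ n)       ≡⟨ lem (ι (suc n)) (ι⁻¹ (suc n)) (cb n) (¼ ^ n) ⟩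
        ι (suc n) * (cat n * ¼ ^ n)                      ∎

  D-summand : ∀ n → D n summand 0 ≡ ι (suc n) * D n mean 0
  D-summand n = D-partial-sums n summand mean ι*mean

  -- The term i = 1 of the expansion is t n c(n) / 6, which need not be divisible by t when p = 3.
  mean≈c+⅓t : (∀ e → t ^ suc (suc e) * β (suc (suc e)) (suc (suc e)) ∈ t ·ℤ₍ p ₎) →
              ∀ n ε → u ^ n * (c n * ι n) * ℚ.½ - ε ∈ ι 3 ·ℤ₍ p ₎ →
              mean n - (c n * ¼ ^ n + t * ι⁻¹ 3 * ε) ∈ t ·ℤ₍ p ₎
  mean≈c+⅓t t^i*β∈t n ε ε∈ = ∈-cong (begin
    u ^ n * (expansion n - t * (c n * ι n) * ⅙) + c n * (u ^ n - ¼ ^ n) + t * ι⁻¹ 3 * (u ^ n * (c n * ι n) * ℚ.½ - ε)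
      ≡⟨ lem (u ^ n) (expansion n) t (c n) (ι n) (¼ ^ n) ε ⟩
    u ^ n * (c n + expansion n) - (c n * ¼ ^ n + t * ι⁻¹ 3 * ε)
      ≡⟨ cong (_- (c n * ¼ ^ n + t * ι⁻¹ 3 * ε)) (mean-expansion n) ⟨
    mean n - (c n * ¼ ^ n + t * ι⁻¹ 3 * ε) ∎)
    (∈-+ (∈-+ (∈-* (u ^ n) (^-integral n u-integral) (expansion∈ n)) (∈-* (c n) (c-integral n) (u^≈¼^ n)))
      -- An error in the ideal of 3, scaled by t/3, lands in the ideal of t; hence ε matters only
      -- modulo 3.
      (subst (t * ι⁻¹ 3 * (u ^ n * (c n * ι n) * ℚ.½ - ε) ∈_·ℤ₍ p ₎) (t⅓3 t) (∈-scale (t * ι⁻¹ 3) ε∈)))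
    where
    ⅙ : ℚ
    ⅙ = ι⁻¹ 6
    t⅓3 : ∀ t → t * ι⁻¹ 3 * ι 3 ≡ t
    t⅓3 = solve-∀ ring
    lem : ∀ u x t y n q e → u * (x - t * (y * n) * ⅙) + y * (u - q) + t * ι⁻¹ 3 * (u * (y * n) * ℚ.½ - e)
        ≡ u * (y + x) - (y * q + t * ι⁻¹ 3 * e)
    lem = solve-∀ ring
    expansion∈ : ∀ n → expansion n - t * (c n * ι n) * ⅙ ∈ t ·ℤ₍ p ₎
    -- For n = 0 there is no term i = 1, and the correction vanishes through the factor `ι 0`.
    expansion∈ zero = ∈-cong (lem₀ t) ∈-zero
      where
      lem₀ : ∀ t → 0ℚ ≡ 0ℚ - t * (1ℚ * 0ℚ) * ⅙
      lem₀ = solve-∀ ring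
    expansion∈ n@(suc n-1) = ∈-cong (begin
      rest                                              ≡⟨ lem₁ t (c n) (ι n) rest ⟩
      (t * 1ℚ * (c n * ι n * ⅙) + rest) - t * (c n * ι n) * ⅙
        ≡⟨ cong (λ x → (t * 1ℚ * (c n * ι x * ⅙) + rest) - t * (c n * ι n) * ⅙) (nC1≡n n) ⟨
      (t * 1ℚ * coeff n 1 + rest) - t * (c n * ι n) * ⅙ ∎)
      (∑-∈ n-1 _ (λ e _ → t^i*coeff-∈ n (suc e) (t^i*β∈t e)))
      where
      rest = ∑< n-1 (λ i → t ^ suc (suc i) * coeff n (suc (suc i)))
      lem₁ : ∀ t x y z → z ≡ (t * 1ℚ * (x * y * ⅙) + z) - t * (x * y) * ⅙
      lem₁ = solve-∀ ring

-- Arithmetic modulo 3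

module _ where

  prime[3] : Prime 3
  prime[3] = from-yes (prime? 3)

  open LocalRing prime[3]

  3∤2 : ¬ (3 ∣ 2)
  3∤2 = from-no (3 ∣? 2)

  -- n (n + 1) (2n + 1) = 6 (1² + ⋯ + n²).
  n[n+1][2n+1]∈3 : ∀ n → ι n * ι (suc n) * (1ℚ + ι 2 * ι n) ∈ ι 3 ·ℤ₍ 3 ₎
  n[n+1][2n+1]∈3 zero = ∈-zero
  n[n+1][2n+1]∈3 (suc n) = ∈-cong (begin
    ι n * ι (suc n) * (1ℚ + ι 2 * ι n) + ι 3 * (ι 2 * (ι (suc n) * ι (suc n)))
      ≡⟨ cong (λ x → ι n * x * (1ℚ + ι 2 * ι n) + ι 3 * (ι 2 * (x * x))) (ι-suc n) ⟩
    ι n * (1ℚ + ι n) * (1ℚ + ι 2 * ι n) + ι 3 * (ι 2 * ((1ℚ + ι n) * (1ℚ + ι n)))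
      ≡⟨ lem (ι n) ⟩
    (1ℚ + ι n) * (1ℚ + (1ℚ + ι n)) * (1ℚ + ι 2 * (1ℚ + ι n))
      ≡⟨ cong (λ x → x * (1ℚ + x) * (1ℚ + ι 2 * x)) (ι-suc n) ⟨
    ι (suc n) * (1ℚ + ι (suc n)) * (1ℚ + ι 2 * ι (suc n))
      ≡⟨ cong (λ x → ι (suc n) * x * (1ℚ + ι 2 * ι (suc n))) (ι-suc (suc n)) ⟨
    ι (suc n) * ι (suc (suc n)) * (1ℚ + ι 2 * ι (suc n)) ∎)
    (∈-+ (n[n+1][2n+1]∈3 n) (generates (*-integral (ι-integral 2) (*-integral (ι-integral (suc n)) (ι-integral (suc n))))))
    where
    lem : ∀ n → n * (1ℚ + n) * (1ℚ + ι 2 * n) + ι 3 * (ι 2 * ((1ℚ + n) * (1ℚ + n))) ≡ (1ℚ + n) * (1ℚ + (1ℚ + n)) * (1ℚ + ι 2 * (1ℚ + n))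
    lem = solve-∀ ring

  -- The product n(n+1)(2n+1) C(2n,n) equals (n+1)² n c(n), and n + 1 is a unit.
  3∤n+1⇒c*n∈3 : ∀ n → ¬ (3 ∣ suc n) → c n * ι n ∈ ι 3 ·ℤ₍ 3 ₎
  3∤n+1⇒c*n∈3 n 3∤ = ∈-cancel (r * r) (ι (suc n) * ι (suc n)) (*-integral ir ir) r²
    (∈-cong (begin
      cb n * (ι n * ι (suc n) * (1ℚ + ι 2 * ι n))       ≡⟨ lem (cb n) (ι n) (ι (suc n)) (1ℚ + ι 2 * ι n) ⟩
      ι (suc n) * ((1ℚ + ι 2 * ι n) * cb n) * ι n       ≡⟨ cong (λ x → ι (suc n) * x * ι n) (c-cb n) ⟨
      ι (suc n) * (ι (suc n) * c n) * ι n               ≡⟨ lem′ (ι (suc n)) (c n) (ι n) ⟩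
      ι (suc n) * ι (suc n) * (c n * ι n)               ∎)
      (∈-* (cb n) (binom-integral (2 ℕ.* n) n) (n[n+1][2n+1]∈3 n)))
    where
    r = ι⁻¹ (suc n)
    ir = ι⁻¹-integral (suc n) 3∤
    lem : ∀ x n s k → x * (n * s * k) ≡ s * (k * x) * n
    lem = solve-∀ ring
    lem′ : ∀ s x n → s * (s * x) * n ≡ s * s * (x * n)
    lem′ = solve-∀ ring
    r² : r * r * (ι (suc n) * ι (suc n)) ≡ 1ℚ
    r² = trans (lem″ r (ι (suc n))) (cong₂ _*_ (*-inverse-ι (suc n)) (*-inverse-ι (suc n)))
      where
      lem″ : ∀ x y → x * x * (y * y) ≡ (x * y) * (x * y)
      lem″ = solve-∀ ring

  -- Modulo 3, n ≡ -1.
  3∣n+1⇒c*n≈-c : ∀ n ε → 3 ∣ suc n → c n - ε ∈ ι 3 ·ℤ₍ 3 ₎ → c n * ι n + ε ∈ ι 3 ·ℤ₍ 3 ₎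
  3∣n+1⇒c*n≈-c n ε (divides k eq) c≈ε = ∈-cong (begin
    ι 3 * (ι k * c n) - (c n - ε)   ≡⟨ lem (ι k) (c n) ε ⟩
    c n * (ι k * ι 3 - 1ℚ) + ε      ≡⟨ cong (λ x → c n * (x - 1ℚ) + ε) (ι-* k 3) ⟨
    c n * (ι (k ℕ.* 3) - 1ℚ) + ε    ≡⟨ cong (λ x → c n * (ι x - 1ℚ) + ε) eq ⟨
    c n * (ι (suc n) - 1ℚ) + ε      ≡⟨ cong (λ x → c n * (x - 1ℚ) + ε) (ι-suc n) ⟩
    c n * (1ℚ + ι n - 1ℚ) + ε       ≡⟨ lem′ (c n) (ι n) ε ⟩
    c n * ι n + ε                   ∎)
    (∈-- (generates (*-integral (ι-integral k) (c-integral n))) c≈ε)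
    where
    lem : ∀ k x e → ι 3 * (k * x) - (x - e) ≡ x * (k * ι 3 - 1ℚ) + e
    lem = solve-∀ ring
    lem′ : ∀ x n e → x * (1ℚ + n - 1ℚ) + e ≡ x * n + e
    lem′ = solve-∀ ring

  -- Modulo 3, both u ≡ 1 and ½ ≡ -1.
  u^*c*n*½≈ε : ∀ {u} → Integral 3 u → u - 1ℚ ∈ ι 3 ·ℤ₍ 3 ₎ → ∀ n ε →
               c n * ι n + ε ∈ ι 3 ·ℤ₍ 3 ₎ → u ^ n * (c n * ι n) * ℚ.½ - ε ∈ ι 3 ·ℤ₍ 3 ₎
  u^*c*n*½≈ε {u} iu u≈1 n ε cn≈-ε = ∈-cong (lem (u ^ n) (c n * ι n) ε)
    (∈-- (∈-+ (∈-* (c n * ι n * ℚ.½) (*-integral icn i½) u^≈1) (generates (*-integral icn i½))) cn≈-ε)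
    where
    icn = *-integral (c-integral n) (ι-integral n)
    i½ = ι⁻¹-integral 2 3∤2
    u^≈1 : u ^ n - 1ℚ ∈ ι 3 ·ℤ₍ 3 ₎
    u^≈1 = ∈-cong (cong (_-_ (u ^ n)) (1^n≡1 n)) (≈-^ n iu (ι-integral 1) u≈1)
    lem : ∀ u x e → x * ℚ.½ * (u - 1ℚ) + ι 3 * (x * ℚ.½) - (x + e) ≡ u * x * ℚ.½ - e
    lem = solve-∀ ring

-- Prime powers, the inequality 2i + 1 < pⁱ, Iverson brackets.

c-p^a : ∀ {p} (pp : Prime p) → ¬ (p ∣ 2) → ∀ a N → suc N ≡ p ℕ.^ a → c N - 1ℚ ∈ ι p ·ℤ₍ p ₎
-- Matching on p exposes the successor that `Frobenius` expects. The congruence is then taken at s =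
-- 0, where c(0) = 1.
c-p^a {zero}  pp _   = ⊥-elim (¬prime[0] pp)
c-p^a {suc _} pp p∤2 a N eq = Frobenius.c-frobenius pp p∤2 a N 0 (trans eq (sym (ℕ.*-identityˡ _)))

¼^-p^a : ∀ {p} (pp : Prime p) → ¬ (p ∣ 4) → ∀ a N → suc N ≡ p ℕ.^ a → ¼ ^ N - 1ℚ ∈ ι p ·ℤ₍ p ₎
¼^-p^a {zero}  pp _   = ⊥-elim (¬prime[0] pp)
¼^-p^a {suc _} pp p∤4 = Frobenius.¼^-≈1 pp p∤4

∣⇒n/d≡suc : ∀ n .{{_ : NonZero n}} d .{{_ : NonZero d}} → d ∣ n → ∃[ s ] (n ℕ./ d ≡ suc s × n ≡ suc s ℕ.* d)
∣⇒n/d≡suc n d (divides zero refl) = ⊥-elim (ℕ.≢-nonZero⁻¹ n refl)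
∣⇒n/d≡suc n d (divides (suc s) refl) = s , m*n/n≡m (suc s) d , refl

-- The left side grows by 2 while x = pⁱ becomes at least 3x, and 2 + x ≤ 3x.
growth-step : ∀ {p} e → 3 ℕ.≤ p → suc (suc e ℕ.+ suc e) ℕ.< p ℕ.^ suc e →
              suc (suc (suc e) ℕ.+ suc (suc e)) ℕ.< p ℕ.^ suc (suc e)
growth-step {p} e 3≤p lt = subst (λ k → suc (suc k) ℕ.< p ℕ.* x) (sym (ℕ.+-suc (suc e) (suc e)))
  (ℕ.<-≤-trans (ℕ.+-monoʳ-< 2 lt) (ℕ.≤-trans
    (subst (2 ℕ.+ x ℕ.≤_) (lem x) (ℕ.+-monoˡ-≤ x (ℕ.+-mono-≤ 1≤x 1≤x)))
    (ℕ.*-monoˡ-≤ x 3≤p)))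
  where
  x = p ℕ.^ suc e
  1≤x : 1 ℕ.≤ x
  1≤x = ℕ.≤-trans (ℕ.s≤s ℕ.z≤n) lt
  lem : ∀ x → x ℕ.+ x ℕ.+ x ≡ 3 ℕ.* x
  lem = ℕ.solve-∀

growth : ∀ {p} → 3 ℕ.< p → ∀ e → suc (suc e ℕ.+ suc e) ℕ.< p ℕ.^ suc e
growth {p} 3<p zero    = subst (3 ℕ.<_) (sym (ℕ.*-identityʳ p)) 3<p
growth     3<p (suc e) = growth-step e (ℕ.<⇒≤ 3<p) (growth 3<p e)

-- For p = 3 both sides equal 3 at i = 1, so the induction starts at i = 2 with 5 < 9.
growth₃ : ∀ e → suc (suc (suc e) ℕ.+ suc (suc e)) ℕ.< 3 ℕ.^ suc (suc e)
growth₃ zero    = from-yes (5 ℕ.<? 9)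
growth₃ (suc e) = growth-step (suc e) ℕ.≤-refl (growth₃ e)

⟦⟧-yes : ∀ {P : Set} (P? : Dec P) → P → ⟦ P? ⟧ ≡ + 1
⟦⟧-yes (yes _) _ = refl
⟦⟧-yes (no ¬P) P = ⊥-elim (¬P P)

⟦⟧-no : ∀ {P : Set} (P? : Dec P) → ¬ P → ⟦ P? ⟧ ≡ + 0
⟦⟧-no (yes P) ¬P = ⊥-elim (¬P P)
⟦⟧-no (no _)  _  = refl

-- The congruences for given m and p.

module Congruences (m : ℤ) (p : ℕ) (pp : Prime p) (odd : ¬ (2 ∣ p)) (p∣m-4 : + p ℤ.∣ (m ℤ.- + 4)) where

  open LocalRing pp
  open Valuation pp

  instance
    m≢0 : ℤ.NonZero m
    m≢0 = p∣m-4⇒m≢0 {m} {p} pp odd p∣m-4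

  2≤p : 2 ℕ.≤ p
  2≤p = ℕ.nonTrivial⇒n>1 p {{prime⇒nonTrivial pp}}

  p∤2 : ¬ (p ∣ 2)
  p∤2 p∣2 = odd (subst (2 ∣_) (ℕ.≤-antisym 2≤p (∣⇒≤ p∣2)) ∣-refl)

  p∤4 : ¬ (p ∣ 4)
  p∤4 p∣4 = [ p∤2 , p∤2 ]′ (euclidsLemma 2 2 pp p∣4)

  3≤p : 3 ℕ.≤ p
  3≤p = ℕ.≤∧≢⇒< 2≤p (λ { refl → odd ∣-refl })

  M t u : ℚ
  M = fromℤ m
  t = fromℤ (m ℤ.- + 4)
  u = ℚ.1/ M

  M≡4+t : M ≡ ι 4 + t
  M≡4+t = trans (cong fromℤ (lem m)) (fromℤ-homo-+ (+ 4) (m ℤ.- + 4))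
    where
    lem : ∀ m → m ≡ + 4 ℤ.+ (m ℤ.- + 4)
    lem = ℤ.solve-∀

  u*M≡1 : u * M ≡ 1ℚ
  u*M≡1 = ℚ.*-inverseˡ M

  -- The quotient (m-4)/p, the generator that remains when one factor p of the modulus is given up.
  k : ℤ
  k = Signed.quotient (∣ᵤ⇒∣ {+ p} {m ℤ.- + 4} p∣m-4)

  m-4≡p*k : m ℤ.- + 4 ≡ + p ℤ.* k
  m-4≡p*k = trans (Signed._∣_.equality (∣ᵤ⇒∣ {+ p} {m ℤ.- + 4} p∣m-4)) (ℤ.*-comm k (+ p))

  t≡p*k : t ≡ ι p * fromℤ k
  t≡p*k = trans (cong fromℤ m-4≡p*k) (fromℤ-homo-* (+ p) k)

  t∈p : t ∈ ι p ·ℤ₍ p ₎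
  t∈p = multiple (fromℤ-integral k) t≡p*k

  p∤∣m∣ : ¬ (p ∣ ℤ.∣ m ∣)
  p∤∣m∣ p∣m = p∤4 (∣⇒∣ᵤ {+ p} {+ 4} (subst (+ p Signed.∣_) (lem m)
    (Signed.∣m∣n⇒∣m-n (∣ᵤ⇒∣ {+ p} {m} p∣m) (∣ᵤ⇒∣ {+ p} {m ℤ.- + 4} p∣m-4))))
    where
    lem : ∀ m → m ℤ.- (m ℤ.- + 4) ≡ + 4
    lem = ℤ.solve-∀

  u-integral : Integral p u
  u-integral = integral-inverse m p∤∣m∣ u*M≡1
    where
    integral-inverse : ∀ i {x} → ¬ (p ∣ ℤ.∣ i ∣) → x * fromℤ i ≡ 1ℚ → Integral p x
    integral-inverse (+ n)    p∤n eq = integral (+ 1) n p∤n eq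
    -- Denominators are natural numbers, so the sign of m moves to the numerator.
    integral-inverse -[1+ n ] {x} p∤n eq = integral -1ℤ (suc n) p∤n
      (trans (lem x (ι (suc n))) (cong -_ (trans (cong (x *_) (sym (fromℤ-homo‿- (+ suc n)))) eq)))
      where
      lem : ∀ x y → x * y ≡ - (x * - y)
      lem = solve-∀ ring

  summand : ℕ → ℚ
  summand = Defs.term m

  M^k*summand : ∀ k → M ^ k * summand k ≡ cb k
  M^k*summand k = begin
    M ^ k * (cb k * ℚ.1/ y)          ≡⟨ cong (_* (cb k * ℚ.1/ y)) (fromℤ-homo-^ m k) ⟨
    y * (cb k * ℚ.1/ y)              ≡⟨ lem y (cb k) (ℚ.1/ y) ⟩
    cb k * (y * ℚ.1/ y)              ≡⟨ cong (cb k *_) (ℚ.*-inverseʳ y) ⟩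
    cb k * 1ℚ                        ≡⟨ ℚ.*-identityʳ (cb k) ⟩
    cb k                             ∎
    where
    y = fromℤ (m ℤ.^ k)
    instance _ = ^-nonZero m k
    lem : ∀ x y z → x * (y * z) ≡ y * (x * z)
    lem = solve-∀ ring

  open Sums pp p∤4 {M} {t} {u} M≡4+t u*M≡1 u-integral summand M^k*summand

  S≡ι*mean : ∀ n → S m (suc n) ≡ ι (suc n) * mean n
  S≡ι*mean n = sym (ι*mean n)

  T≡ι*D-mean : ∀ n → T m (suc n) ≡ ι (suc n) * D n mean 0
  T≡ι*D-mean n = trans (∑-cong (suc n) (λ k → cong (_* summand k)
    (trans (fromℤ-homo-* (+ (n C k)) (-1ℤ ℤ.^ k)) (cong (binom n k *_) (fromℤ-homo-^ -1ℤ k)))))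
    (trans (∑-binom-D n summand) (D-summand n))

  ι⁻¹*ι* : ∀ n .{{_ : NonZero n}} x → ι⁻¹ n * (ι n * x) ≡ x
  ι⁻¹*ι* n x = trans (sym (ℚ.*-assoc (ι⁻¹ n) (ι n) x)) (trans (cong (_* x) (*-inverse-ι n)) (ℚ.*-identityˡ x))

  -- The predecessor N is a separate argument because the lemma is also used at pᵃ, which is not a
  -- successor by computation.
  S/n≡mean : ∀ n .{{_ : NonZero n}} N → n ≡ suc N → (+ 1 ℚ./ n) * S m n ≡ mean N
  S/n≡mean n N refl = refl

  T/n≡D-mean : ∀ n .{{_ : NonZero n}} N → n ≡ suc N → (+ 1 ℚ./ n) * T m n ≡ D N mean 0
  T/n≡D-mean n N refl = trans (cong (ι⁻¹ n *_) (T≡ι*D-mean N)) (ι⁻¹*ι* n (D N mean 0))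

  ⅓ : ℚ
  ⅓ = ι⁻¹ 3

  [m-4]/3 : (m ℤ.- + 4) ℚ./ 3 ≡ t * ⅓
  [m-4]/3 = /-unique (m ℤ.- + 4) 3 (lem t)
    where
    lem : ∀ t → t * ⅓ * ι 3 ≡ t
    lem = solve-∀ ring

  [m-1]/3 : (m ℤ.- + 1) ℚ./ 3 ≡ 1ℚ + t * ⅓
  [m-1]/3 = /-unique (m ℤ.- + 1) 3 (begin
    (1ℚ + t * ⅓) * ι 3   ≡⟨ lem t ⟩
    ι 4 + t - 1ℚ         ≡⟨ cong (_- 1ℚ) M≡4+t ⟨
    M - 1ℚ               ≡⟨ fromℤ-homo-+ m (ℤ.- + 1) ⟨
    fromℤ (m ℤ.- + 1)    ∎)
    where
    lem : ∀ t → (1ℚ + t * ⅓) * ι 3 ≡ ι 4 + t - 1ℚ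
    lem = solve-∀ ring

  2n-1 : ∀ n → 2 ℕ.* suc n ℕ.∸ 1 ≡ suc (2 ℕ.* n)
  2n-1 n = cong (ℕ._∸ 1) (2*suc n)

  c/4^ : ∀ n → (+ ((2 ℕ.* suc n ℕ.∸ 1) C n) ℚ./ (4 ℕ.^ n)) {{ℕ.m^n≢0 4 n}} ≡ c n * ¼ ^ n
  c/4^ n = /-unique (+ ((2 ℕ.* suc n ℕ.∸ 1) C n)) (4 ℕ.^ n) {{ℕ.m^n≢0 4 n}} (begin
    c n * ¼ ^ n * ι (4 ℕ.^ n)         ≡⟨ cong (c n * ¼ ^ n *_) (ι-^ 4 n) ⟩
    c n * ¼ ^ n * ι 4 ^ n             ≡⟨ ℚ.*-assoc (c n) (¼ ^ n) (ι 4 ^ n) ⟩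
    c n * (¼ ^ n * ι 4 ^ n)           ≡⟨ cong (c n *_) (^-inverse refl n) ⟩
    c n * 1ℚ                          ≡⟨ ℚ.*-identityʳ (c n) ⟩
    c n                               ≡⟨ cong (λ k → binom k n) (2n-1 n) ⟨
    binom (2 ℕ.* suc n ℕ.∸ 1) n       ∎)

  catalan/4^ : ∀ n → (catalan n ℚ.÷ fromℤ (+ (4 ℕ.^ n))) {{ℕ.m^n≢0 4 n}} ≡ cat n * ¼ ^ n
  catalan/4^ n = ÷-unique {{ℕ.m^n≢0 4 n}} (begin
    cat n * ¼ ^ n * ι (4 ℕ.^ n)       ≡⟨ cong (cat n * ¼ ^ n *_) (ι-^ 4 n) ⟩
    cat n * ¼ ^ n * ι 4 ^ n           ≡⟨ ℚ.*-assoc (cat n) (¼ ^ n) (ι 4 ^ n) ⟩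
    cat n * (¼ ^ n * ι 4 ^ n)         ≡⟨ cong (cat n *_) (^-inverse refl n) ⟩
    cat n * 1ℚ                        ≡⟨ ℚ.*-identityʳ (cat n) ⟩
    cat n                             ≡⟨ /-unique (+ ((2 ℕ.* n) C n)) (suc n) (lem (ι⁻¹ (suc n)) (cb n) (ι (suc n)) (*-inverse-ι (suc n))) ⟨
    catalan n                         ∎)
    where
    lem : ∀ x y z → x * z ≡ 1ℚ → x * y * z ≡ y
    lem x y z xz = trans (lem′ x y z) (trans (cong (_* y) xz) (ℚ.*-identityˡ y))
      where
      lem′ : ∀ x y z → x * y * z ≡ (x * z) * y
      lem′ = solve-∀ ring

  n*integral⇒ν[n]≤ν : ∀ n {q r} → q ≡ ι n * r → Integral p r → νℤ p (+ n) ≤⁺ ν p q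
  n*integral⇒ν[n]≤ν n q≡ ir = ∈⇒νℤ≤ν (+ n) (multiple ir q≡)

  t^i*β∈t₂ : p ≡ 3 → ∀ e → t ^ suc (suc e) * β (suc (suc e)) (suc (suc e)) ∈ t ·ℤ₍ p ₎
  t^i*β∈t₂ p≡3 e = t^i*β-∈ (suc e) t∈p
    (subst (λ q → suc (suc (suc e) ℕ.+ suc (suc e)) ℕ.< q ℕ.^ suc (suc e)) (sym p≡3) (growth₃ e))

  t∈k : t ∈ fromℤ k ·ℤ₍ p ₎
  t∈k = multiple (ι-integral p) (trans t≡p*k (ℚ.*-comm (ι p) (fromℤ k)))

  t^i*β∈t : p ≢ 3 → ∀ e → t ^ suc e * β (suc e) (suc e) ∈ t ·ℤ₍ p ₎
  t^i*β∈t p≢3 e = t^i*β-∈ e t∈p (growth (ℕ.≤∧≢⇒< 3≤p (p≢3 ∘ sym)) e)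

  -- The exceptional term for p = 3 is t/6 = k/2, and 2 is a unit; all the others already lie in the
  -- ideal of t.
  t^i*β∈k : Dec (p ≡ 3) → ∀ e → t ^ suc e * β (suc e) (suc e) ∈ fromℤ k ·ℤ₍ p ₎
  t^i*β∈k (no p≢3)  e       = ∈-trans (t^i*β∈t p≢3 e) t∈k
  t^i*β∈k (yes p≡3) (suc e) = ∈-trans (t^i*β∈t₂ p≡3 e) t∈k
  t^i*β∈k (yes p≡3) zero    = multiple (ι⁻¹-integral 2 p∤2) (begin
    t * 1ℚ * ι⁻¹ 6                   ≡⟨ cong (λ x → x * 1ℚ * ι⁻¹ 6) t≡p*k ⟩
    ι p * fromℤ k * 1ℚ * ι⁻¹ 6       ≡⟨ cong (λ q → ι q * fromℤ k * 1ℚ * ι⁻¹ 6) p≡3 ⟩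
    ι 3 * fromℤ k * 1ℚ * ι⁻¹ 6       ≡⟨ lem (fromℤ k) ⟩
    fromℤ k * ι⁻¹ 2                  ∎)
    where
    lem : ∀ x → ι 3 * x * 1ℚ * ι⁻¹ 6 ≡ x * ι⁻¹ 2
    lem = solve-∀ ring

  all-means-integral : ∀ n → Integral p (mean n)
  all-means-integral = mean-integral t∈k (t^i*β∈k (p ℕ.≟ 3)) (fromℤ-integral k)

  ν[n]≤ν[S] : ∀ n → νℤ p (+ suc n) ≤⁺ ν p (S m (suc n))
  ν[n]≤ν[S] n = n*integral⇒ν[n]≤ν (suc n) (S≡ι*mean n) (all-means-integral n)

  ν[n]≤ν[T] : ∀ n → νℤ p (+ suc n) ≤⁺ ν p (T m (suc n))
  ν[n]≤ν[T] n = n*integral⇒ν[n]≤ν (suc n) (T≡ι*D-mean n) (D-integral n mean all-means-integral 0)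

  δ≡0 : p ≢ 3 → δ p 3 ≡ + 0
  δ≡0 = ⟦⟧-no (p ℕ.≟ 3)

  δ≡1 : p ≡ 3 → δ p 3 ≡ + 1
  δ≡1 = ⟦⟧-yes (p ℕ.≟ 3)

  -- Any integer i congruent to -n c(n) modulo 3 may describe the exceptional term: the bracket
  -- times a binomial coefficient in general, 1 at prime powers.
  mean≈c+δ : ∀ n i → (p ≡ 3 → c n * ι n + fromℤ i ∈ ι 3 ·ℤ₍ 3 ₎) → Dec (p ≡ 3) →
             mean n - (c n * ¼ ^ n + t * ⅓ * fromℤ (δ p 3 ℤ.* i)) ∈ t ·ℤ₍ p ₎
  mean≈c+δ n i _ (no p≢3) = ∈-cong (cong (_-_ (mean n)) (trans (lem (c n * ¼ ^ n) (t * ⅓))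
    (cong (λ x → c n * ¼ ^ n + t * ⅓ * fromℤ x) (sym (cong (ℤ._* i) (δ≡0 p≢3))))))
    (mean≈c ∈-refl (t^i*β∈t p≢3) n)
    where
    lem : ∀ x y → x ≡ x + y * 0ℚ
    lem = solve-∀ ring
  mean≈c+δ n i cn≈-i (yes p≡3) =
    subst (λ x → mean n - (c n * ¼ ^ n + t * ⅓ * fromℤ x) ∈ t ·ℤ₍ p ₎) (sym (trans (cong (ℤ._* i) (δ≡1 p≡3)) (ℤ.*-identityˡ i)))
      (mean≈c+⅓t (t^i*β∈t₂ p≡3) n (fromℤ i)
        (subst (λ q → u ^ n * (c n * ι n) * ℚ.½ - fromℤ i ∈ ι 3 ·ℤ₍ q ₎) (sym p≡3)
          (u^*c*n*½≈ε (subst (λ q → Integral q u) p≡3 u-integral) u≈1 n (fromℤ i) (cn≈-i p≡3))))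
    where
    u≈1 : u - 1ℚ ∈ ι 3 ·ℤ₍ 3 ₎
    u≈1 = subst (λ q → u - 1ℚ ∈ ι q ·ℤ₍ q ₎) p≡3 (∈-cong (begin
      - (u * (ι p + t))        ≡⟨ cong (λ q → - (u * (ι q + t))) p≡3 ⟩
      - (u * (ι 3 + t))        ≡⟨ lem u t ⟩
      u - u * (ι 4 + t)        ≡⟨ cong (λ x → u - u * x) M≡4+t ⟨
      u - u * M                ≡⟨ cong (_-_ u) u*M≡1 ⟩
      u - 1ℚ                   ∎)
      (∈-neg (∈-* u u-integral (∈-+ ∈-refl t∈p))))
      where
      lem : ∀ u t → - (u * (ι 3 + t)) ≡ u - u * (ι 4 + t)
      lem = solve-∀ ring

  S/n≋ : ∀ n → let q = cofactor 3 (suc n) in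
    (+ 1 ℚ./ suc n) * S m (suc n)
      ≋ ((+ ((2 ℕ.* suc n ℕ.∸ 1) C n) ℚ./ (4 ℕ.^ n)) {{ℕ.m^n≢0 4 n}}
         + fromℤ (δ p 3 ℤ.* ⟦ 3 ∣? suc n ⟧) * ((m ℤ.- + 4) ℚ./ 3) * fromℤ (+ ((2 ℕ.* q ℕ.∸ 1) C (q ℕ.∸ 1))))
      [mod p ↑ νℤ p (m ℤ.- + 4) ]
  S/n≋ n = ∈⇒νℤ≤ν (m ℤ.- + 4) (∈-cong (cong (_-_ (mean n)) (begin
    c n * ¼ ^ n + t * ⅓ * fromℤ (δ p 3 ℤ.* (b ℤ.* + x))     ≡⟨ cong (λ y → c n * ¼ ^ n + t * ⅓ * fromℤ y) (ℤ.*-assoc (δ p 3) b (+ x)) ⟨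
    c n * ¼ ^ n + t * ⅓ * fromℤ (δ p 3 ℤ.* b ℤ.* + x)       ≡⟨ cong (λ y → c n * ¼ ^ n + t * ⅓ * y) (fromℤ-homo-* (δ p 3 ℤ.* b) (+ x)) ⟩
    c n * ¼ ^ n + t * ⅓ * (fromℤ (δ p 3 ℤ.* b) * ι x)       ≡⟨ cong (_+_ (c n * ¼ ^ n)) (lem (t * ⅓) (fromℤ (δ p 3 ℤ.* b)) (ι x)) ⟩
    c n * ¼ ^ n + fromℤ (δ p 3 ℤ.* b) * (t * ⅓) * ι x       ≡⟨ cong₂ (λ y z → y + fromℤ (δ p 3 ℤ.* b) * z * ι x) (c/4^ n) [m-4]/3 ⟨
    (+ ((2 ℕ.* suc n ℕ.∸ 1) C n) ℚ./ (4 ℕ.^ n)) {{ℕ.m^n≢0 4 n}} + fromℤ (δ p 3 ℤ.* b) * ((m ℤ.- + 4) ℚ./ 3) * ι x ∎))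
    (mean≈c+δ n (b ℤ.* + x) (λ _ → cn≈-bx (3 ∣? suc n)) (p ℕ.≟ 3)))
    where
    q = cofactor 3 (suc n)
    b = ⟦ 3 ∣? suc n ⟧
    x = (2 ℕ.* q ℕ.∸ 1) C (q ℕ.∸ 1)
    lem : ∀ x y z → x * (y * z) ≡ y * x * z
    lem = solve-∀ ring
    cn≈-bx : Dec (3 ∣ suc n) → c n * ι n + fromℤ (b ℤ.* + x) ∈ ι 3 ·ℤ₍ 3 ₎
    cn≈-bx (no 3∤) = subst (λ y → c n * ι n + fromℤ (y ℤ.* + x) ∈ ι 3 ·ℤ₍ 3 ₎) (sym (⟦⟧-no (3 ∣? suc n) 3∤))
      (subst (_∈ ι 3 ·ℤ₍ 3 ₎) (sym (ℚ.+-identityʳ (c n * ι n))) (3∤n+1⇒c*n∈3 n 3∤))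
    cn≈-bx (yes 3∣) = subst (λ y → c n * ι n + fromℤ y ∈ ι 3 ·ℤ₍ 3 ₎)
      (sym (trans (cong (ℤ._* + x) (⟦⟧-yes (3 ∣? suc n) 3∣)) (ℤ.*-identityˡ (+ x))))
      (3∣n+1⇒c*n≈-c n (ι x) 3∣ c≈x)
      where
      c≈x : c n - ι x ∈ ι 3 ·ℤ₍ 3 ₎
      -- The full power of 3 is split off n + 1, leaving the cofactor as `suc s`; `c-frobenius` then
      -- replaces c(n) by c(s).
      c≈x with ∣⇒n/d≡suc (suc n) (3 ℕ.^ νℕ 3 (suc n)) {{ℕ.m^n≢0 3 (νℕ 3 (suc n))}} (νℕ-divides 3 (suc n))
      ... | s , q≡ , n≡ = subst (λ y → c n - ι y ∈ ι 3 ·ℤ₍ 3 ₎)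
        (sym (trans (cong (λ q → (2 ℕ.* q ℕ.∸ 1) C (q ℕ.∸ 1)) q≡) (cong (_C s) (2n-1 s))))
        (Frobenius.c-frobenius prime[3] 3∤2 (νℕ 3 (suc n)) n s n≡)

  D-mean≋ : Dec (p ≡ 3) → ∀ n → νℤ p (m ℤ.- + 4) -⁺ δ p 3 ≤⁺ ν p (D n mean 0 - cat n * ¼ ^ n)
  D-mean≋ (no p≢3) n = subst (_≤⁺ ν p (D n mean 0 - cat n * ¼ ^ n))
    (trans (sym (-⁺-identityʳ (νℤ p (m ℤ.- + 4)))) (cong (νℤ p (m ℤ.- + 4) -⁺_) (sym (δ≡0 p≢3))))
    (∈⇒νℤ≤ν (m ℤ.- + 4) (D-mean≈cat ∈-refl (t^i*β∈t p≢3) n))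
    where
    -⁺-identityʳ : ∀ i → i -⁺ + 0 ≡ i
    -⁺-identityʳ ⊤⁺    = refl
    -⁺-identityʳ [ i ] = cong [_] (ℤ.+-identityʳ i)
  D-mean≋ (yes p≡3) n = subst (λ i → νℤ p (m ℤ.- + 4) -⁺ i ≤⁺ ν p (D n mean 0 - cat n * ¼ ^ n)) (sym (δ≡1 p≡3))
    (∈⇒νℤ-1≤ν (m ℤ.- + 4) k m-4≡p*k (D-mean≈cat t∈k (t^i*β∈k (yes p≡3)) n))

  T/n≋ : ∀ n → (+ 1 ℚ./ suc n) * T m (suc n) ≋ (catalan n ℚ.÷ fromℤ (+ (4 ℕ.^ n))) {{ℕ.m^n≢0 4 n}}
               [mod p ↑ νℤ p (m ℤ.- + 4) -⁺ δ p 3 ]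
  T/n≋ n = subst₂ (λ x y → x ≋ y [mod p ↑ νℤ p (m ℤ.- + 4) -⁺ δ p 3 ]) (sym (T/n≡D-mean (suc n) n refl)) (sym (catalan/4^ n))
    (D-mean≋ (p ℕ.≟ 3) n)

  ∈p⇒1≤ν : ∀ {q} → q ∈ ι p ·ℤ₍ p ₎ → [ + 1 ] ≤⁺ ν p q
  ∈p⇒1≤ν = ∈⇒≤ν 1 (+ p) (subst (_∣ p) (sym (ℕ.*-identityʳ p)) ∣-refl)

  -- As (m-1)/3 = 1 + (m-4)/3, the two sides are equal for p = 3; otherwise 3 is a unit and t/3 lies
  -- in the ideal of p.
  1+δ≋[m-1]/3 : Dec (p ≡ 3) → 1ℚ + fromℤ (δ p 3) * ((m ℤ.- + 4) ℚ./ 3) ≋ (m ℤ.- + 1) ℚ./ 3 [mod p ↑ [ + 1 ] ]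
  1+δ≋[m-1]/3 p≟3 = ∈p⇒1≤ν (∈-cong (cong₂ (λ x y → 1ℚ + fromℤ (δ p 3) * x - y) (sym [m-4]/3) (sym [m-1]/3)) (go p≟3))
    where
    go : Dec (p ≡ 3) → 1ℚ + fromℤ (δ p 3) * (t * ⅓) - (1ℚ + t * ⅓) ∈ ι p ·ℤ₍ p ₎
    go (yes p≡3) = ∈-cong (trans (lem (t * ⅓)) (cong (λ x → 1ℚ + fromℤ x * (t * ⅓) - (1ℚ + t * ⅓)) (sym (δ≡1 p≡3)))) ∈-zero
      where
      lem : ∀ x → 0ℚ ≡ 1ℚ + 1ℚ * x - (1ℚ + x)
      lem = solve-∀ ring
    go (no p≢3) = ∈-cong (trans (lem t) (cong (λ x → 1ℚ + fromℤ x * (t * ⅓) - (1ℚ + t * ⅓)) (sym (δ≡0 p≢3))))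
      (∈-neg (∈-* ⅓ (ι⁻¹-integral 3 p∤3) t∈p))
      where
      p∤3 : ¬ (p ∣ 3)
      p∤3 p∣3 = p≢3 (ℕ.≤-antisym (∣⇒≤ p∣3) 3≤p)
      lem : ∀ t → - (⅓ * t) ≡ 1ℚ + 0ℚ * (t * ⅓) - (1ℚ + t * ⅓)
      lem = solve-∀ ring

  module PrimePower (a N : ℕ) .{{_ : NonZero a}} (N+1≡p^a : suc N ≡ p ℕ.^ a) where

    private instance
      p^a≢0 : NonZero (p ℕ.^ a)
      p^a≢0 = prime^≢0 pp a

    c≈1 : c N - 1ℚ ∈ ι p ·ℤ₍ p ₎
    c≈1 = c-p^a pp p∤2 a N N+1≡p^a

    ¼^≈1 : ¼ ^ N - 1ℚ ∈ ι p ·ℤ₍ p ₎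
    ¼^≈1 = ¼^-p^a pp p∤4 a N N+1≡p^a

    p∣N+1 : p ∣ suc N
    p∣N+1 = subst (p ∣_) (trans (cong (p ℕ.^_) (ℕ.suc-pred a)) (sym N+1≡p^a)) (m∣m*n (p ℕ.^ ℕ.pred a))

    -- For p = 3, N ≡ -1 and c(N) ≡ 1 allow i = 1 in `mean≈c+δ`.
    S/p^a≋ : (+ 1 ℚ./ (p ℕ.^ a)) * S m (p ℕ.^ a) ≋ 1ℚ + fromℤ (δ p 3) * ((m ℤ.- + 4) ℚ./ 3) [mod p ↑ [ + 1 ] ]
    S/p^a≋ = ∈p⇒1≤ν (∈-cong (begin
      (mean N - (c N * ¼ ^ N + t * ⅓ * fromℤ (δ p 3 ℤ.* + 1))) + (c N * ¼ ^ N - 1ℚ * 1ℚ)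
        ≡⟨ cong (λ x → (mean N - (c N * ¼ ^ N + t * ⅓ * fromℤ x)) + (c N * ¼ ^ N - 1ℚ * 1ℚ)) (ℤ.*-identityʳ (δ p 3)) ⟩
      (mean N - (c N * ¼ ^ N + t * ⅓ * fromℤ (δ p 3))) + (c N * ¼ ^ N - 1ℚ * 1ℚ)
        ≡⟨ lem (mean N) (c N * ¼ ^ N) (t * ⅓) (fromℤ (δ p 3)) ⟩
      mean N - (1ℚ + fromℤ (δ p 3) * (t * ⅓))
        ≡⟨ cong₂ (λ x y → x - (1ℚ + fromℤ (δ p 3) * y)) (S/n≡mean (p ℕ.^ a) N (sym N+1≡p^a)) [m-4]/3 ⟨
      (+ 1 ℚ./ (p ℕ.^ a)) * S m (p ℕ.^ a) - (1ℚ + fromℤ (δ p 3) * ((m ℤ.- + 4) ℚ./ 3)) ∎)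
      (∈-+ (∈-trans (mean≈c+δ N (+ 1) cn≈-1 (p ℕ.≟ 3)) t∈p)
           (≈-* (c N) 1ℚ (¼ ^ N) 1ℚ (c-integral N) (ι-integral 1) c≈1 ¼^≈1)))
      where
      cn≈-1 : p ≡ 3 → c N * ι N + 1ℚ ∈ ι 3 ·ℤ₍ 3 ₎
      cn≈-1 p≡3 = 3∣n+1⇒c*n≈-c N 1ℚ (subst (_∣ suc N) p≡3 p∣N+1) (subst (λ q → c N - 1ℚ ∈ ι q ·ℤ₍ q ₎) p≡3 c≈1)
      lem : ∀ x y z w → (x - (y + z * w)) + (y - 1ℚ * 1ℚ) ≡ x - (1ℚ + w * z)
      lem = solve-∀ ring

    -- c(N) is 2N + 1 times the Catalan number, with c(N) ≡ 1 and 2N + 1 = 2(N+1) - 1 ≡ -1.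
    cat≈-1 : cat N - -1ℚ ∈ ι p ·ℤ₍ p ₎
    cat≈-1 = ∈-cong (begin
      ι 2 * cat N * ι (suc N) - (c N - 1ℚ)                 ≡⟨ cong (λ x → ι 2 * cat N * ι (suc N) - (x - 1ℚ)) c≡ ⟩
      ι 2 * cat N * ι (suc N) - ((1ℚ + ι 2 * ι N) * cat N - 1ℚ) ≡⟨ cong (λ x → ι 2 * cat N * x - ((1ℚ + ι 2 * ι N) * cat N - 1ℚ)) (ι-suc N) ⟩
      ι 2 * cat N * (1ℚ + ι N) - ((1ℚ + ι 2 * ι N) * cat N - 1ℚ) ≡⟨ lem (ι N) (cat N) ⟩
      cat N - -1ℚ                                          ∎)
      (∈-- (∈-* (ι 2 * cat N) (*-integral (ι-integral 2) (cat-integral N)) N+1∈p) c≈1)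
      where
      lem : ∀ n x → ι 2 * x * (1ℚ + n) - ((1ℚ + ι 2 * n) * x - 1ℚ) ≡ x - -1ℚ
      lem = solve-∀ ring
      lem′ : ∀ n k r x → n * (k * (r * x)) ≡ (r * n) * (k * x)
      lem′ = solve-∀ ring
      c≡ : c N ≡ (1ℚ + ι 2 * ι N) * cat N
      c≡ = *-cancelˡ-ι (suc N) (begin
        ι (suc N) * c N                                     ≡⟨ c-cb N ⟩
        (1ℚ + ι 2 * ι N) * cb N                             ≡⟨ ℚ.*-identityˡ _ ⟨
        1ℚ * ((1ℚ + ι 2 * ι N) * cb N)                      ≡⟨ cong (_* ((1ℚ + ι 2 * ι N) * cb N)) (*-inverse-ι (suc N)) ⟨
        (ι⁻¹ (suc N) * ι (suc N)) * ((1ℚ + ι 2 * ι N) * cb N) ≡⟨ lem′ (ι (suc N)) (1ℚ + ι 2 * ι N) (ι⁻¹ (suc N)) (cb N) ⟨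
        ι (suc N) * ((1ℚ + ι 2 * ι N) * cat N)              ∎)
      N+1∈p : ι (suc N) ∈ ι p ·ℤ₍ p ₎
      N+1∈p with p∣N+1
      ... | divides j eq = multiple (ι-integral j) (trans (cong ι eq) (trans (ι-* j p) (ℚ.*-comm (ι j) (ι p))))

    T/p^a≋ : p ≢ 3 → (+ 1 ℚ./ (p ℕ.^ a)) * T m (p ℕ.^ a) ≋ fromℤ -1ℤ [mod p ↑ [ + 1 ] ]
    T/p^a≋ p≢3 = ∈p⇒1≤ν (∈-cong (begin
      (D N mean 0 - cat N * ¼ ^ N) + (cat N * ¼ ^ N - -1ℚ * 1ℚ)  ≡⟨ lem (D N mean 0) (cat N * ¼ ^ N) ⟩
      D N mean 0 - -1ℚ                                        ≡⟨ cong (_- -1ℚ) (T/n≡D-mean (p ℕ.^ a) N (sym N+1≡p^a)) ⟨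
      (+ 1 ℚ./ (p ℕ.^ a)) * T m (p ℕ.^ a) - -1ℚ               ∎)
      (∈-+ (∈-trans (D-mean≈cat ∈-refl (t^i*β∈t p≢3) N) t∈p)
           (≈-* (cat N) -1ℚ (¼ ^ N) 1ℚ (cat-integral N) (ι-integral 1) cat≈-1 ¼^≈1)))
      where
      lem : ∀ x y → (x - y) + (y - -1ℚ * 1ℚ) ≡ x - -1ℚ
      lem = solve-∀ ring

theorem1p1 :
    (m : ℤ) (n : ℕ) .{{_ : NonZero n}} (p : ℕ) →
    (pp : Prime p) (odd : ¬ (2 ∣ p)) (p∣m-4 : + p ℤ.∣ (m ℤ.- + 4)) →
    let instance _ = p∣m-4⇒m≢0 {m} {p} pp odd p∣m-4
        instance _ = ℕ.m^n≢0 4 (n ℕ.∸ 1)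
        q = cofactor 3 n
    in
    (νℤ p (+ n) ≤⁺ ν p (S m n))
    × (νℤ p (+ n) ≤⁺ ν p (T m n))
    × ((+ 1 ℚ./ n) ℚ.* S m n
        ≋ (+ ((2 ℕ.* n ℕ.∸ 1) C (n ℕ.∸ 1)) ℚ./ (4 ℕ.^ (n ℕ.∸ 1))
           ℚ.+ fromℤ (δ p 3 ℤ.* ⟦ 3 ∣? n ⟧) ℚ.* ((m ℤ.- + 4) ℚ./ 3)
               ℚ.* fromℤ (+ ((2 ℕ.* q ℕ.∸ 1) C (q ℕ.∸ 1))))
        [mod p ↑ νℤ p (m ℤ.- + 4) ])
    × ((+ 1 ℚ./ n) ℚ.* T m n
        ≋ catalan (n ℕ.∸ 1) ℚ.÷ fromℤ (+ (4 ℕ.^ (n ℕ.∸ 1)))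
        [mod p ↑ νℤ p (m ℤ.- + 4) -⁺ δ p 3 ])
    × ((a : ℕ) .{{_ : NonZero a}} →
        let instance _ = prime^≢0 pp a in
        ((+ 1 ℚ./ (p ℕ.^ a)) ℚ.* S m (p ℕ.^ a)
          ≋ 1ℚ ℚ.+ fromℤ (δ p 3) ℚ.* ((m ℤ.- + 4) ℚ./ 3)
          [mod p ↑ [ + 1 ] ])
        × (1ℚ ℚ.+ fromℤ (δ p 3) ℚ.* ((m ℤ.- + 4) ℚ./ 3)
          ≋ (m ℤ.- + 1) ℚ./ 3
          [mod p ↑ [ + 1 ] ])
        × (p ≢ 3 →
          (+ 1 ℚ./ (p ℕ.^ a)) ℚ.* T m (p ℕ.^ a)
            ≋ fromℤ -1ℤ
            [mod p ↑ [ + 1 ] ]))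
theorem1p1 m (suc n) p pp odd p∣m-4 =
  ν[n]≤ν[S] n , ν[n]≤ν[T] n , S/n≋ n , T/n≋ n , λ a →
    let open PrimePower a (ℕ.pred (p ℕ.^ a)) (ℕ.suc-pred (p ℕ.^ a) {{prime^≢0 pp a}})
    in S/p^a≋ , 1+δ≋[m-1]/3 (p ℕ.≟ 3) , T/p^a≋
  where open Congruences m p pp odd p∣m-4
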